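{- There exists a constant $C > 0$ such that, for all positive integers $n$, $$\operatorname{xc}(\mathrm{CUT}(n+1)) = \operatorname{xc}(\mathrm{COR}(n)) \geqslant 2^{Cn}.$$ In particular, the extension complexity of $\mathrm{CUT}(n)$ is $2^{\Omega(n)}$.
   Context: A polytope is the convex hull of a finite set of points in some $\mathbb{R}^d$. An extended formulation (EF) of a polytope $P \subseteq \mathbb{R}^d$ is a linear system $E^{=}x + F^{=}y = g^{=},\ E^{\leqslant}x + F^{\leqslant}y \leqslant g^{\leqslant}$ in variables $(x,y)\in\mathbb{R}^{d+k}$ (for some $k \geqslant 0$), with real matrices $E^{=},F^{=},E^{\leqslant},F^{\leqslant}$ and real vectors $g^{=},g^{\leqslant}$, such that $x\in P$ if and only if there exists $y\in\mathbb{R}^k$ such that $(x,y)$ satisfies the system. The size of an EF is its number of inequalities (equalities are not counted). The extension complexity $\operatorname{xc}(P)$ is the minimum size of an EF of $P$. Let $K_n=(V_n,E_n)$ be the complete graph on $n$ vertices. For $X\subseteq V_n$, the cut $\delta(X)\subseteq E_n$ is the set of edges with one endpoint in $X$ and the other in $V_n\setminus X$. For $F\subseteq E_n$, $\chi^F\in\mathbb{R}^{E_n}$ is the characteristic vector of $F$. The cut polytope is $\mathrm{CUT}(n)=\operatorname{conv}\{\chi^{\delta(X)}\in\mathbb{R}^{E_n} \mid X\subseteq V_n\}$. The correlation polytope is $\mathrm{COR}(n)=\operatorname{conv}\{bb^{\intercal}\in\mathbb{R}^{n\times n}\mid b\in\{0,1\}^n\}$, where $b$ is viewed as a column vector. "$2^{\Omega(n)}$"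 means: at least $2^{cn}$ for some constant $c>0$ and all sufficiently large $n$. -}

module Defs where

open import Algebra.Bundles using (CommutativeRing)
open import Data.Bool using (if_then_else_; _xor_)
open import Data.Fin using (Fin; _<?_; combine)
open import Data.Fin.Subset using (Subset)
open import Data.List using (List; length; filter; cartesianProduct; allFin)
import Data.List as List
open import Data.Nat as ℕ using (ℕ)
open import Data.Product using (_×_; _,_; ∃; ∃-syntax; Σ-syntax)
open import Data.Sum using (_⊎_)
open import Data.Vec using (lookup; tabulate)
open import Data.Vec.Functional using (Vector)
open import Function using (_⇔_)
open import Level using (0ℓ) renaming (suc to ℓsuc)
open import Relation.Binary using (Rel; IsTotalOrder)
open import Relation.Nullary using (¬_)
open import Relation.Unary using (Pred)

-- The real numbers, axiomatised as a complete ordered field.  Completeness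
-- is the least-upper-bound property, so any two models are (classically)
-- uniquely isomorphic.

record RealNumbers : Set (ℓsuc 0ℓ) where
  field
    commutativeRing : CommutativeRing 0ℓ 0ℓ

  open CommutativeRing commutativeRing public

  infix 4 _≤_ _<_

  field
    _≤_          : Rel Carrier 0ℓ
    isTotalOrder : IsTotalOrder _≈_ _≤_
    +-monoʳ-≤    : ∀ x {y z} → y ≤ z → x + y ≤ x + z
    *-nonNeg     : ∀ {x y} → 0# ≤ x → 0# ≤ y → 0# ≤ x * y
    0≉1          : ¬ (0# ≈ 1#)
    inverse      : ∀ x → ¬ (x ≈ 0#) → ∃[ y ] x * y ≈ 1#

  _<_ : Rel Carrier 0ℓ
  x < y = x ≤ y × ¬ (x ≈ y)

  IsUpperBound : Pred Carrier 0ℓ → Pred Carrier 0ℓ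
  IsUpperBound S u = ∀ x → S x → x ≤ u

  IsSupremum : Pred Carrier 0ℓ → Pred Carrier 0ℓ
  IsSupremum S s = IsUpperBound S s × (∀ u → IsUpperBound S u → s ≤ u)

  field
    complete : ∀ S → ∃ S → ∃ (IsUpperBound S) → ∃ (IsSupremum S)

-- The edges {i , j} of the complete graph on Fin n, each listed once, as the
-- pair with i < j.

edges : (n : ℕ) → List (Fin n × Fin n)
edges n = filter (λ (i , j) → i <? j) (cartesianProduct (allFin n) (allFin n))

∣E_∣ : ℕ → ℕ
∣E n ∣ = length (edges n)

edge : ∀ n → Fin ∣E n ∣ → Fin n × Fin n
edge n = List.lookup (edges n)

δ : ∀ {n} → Subset n → Subset ∣E n ∣
δ {n} X = tabulate λ e →
  let (i , j) = edge n e in lookup X i xor lookup X j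

module Polytopes (R : RealNumbers) where

  open RealNumbers R renaming (Carrier to ℝ) public
  open import Algebra.Properties.Semiring.Sum semiring public using (sum)
  open import Algebra.Properties.Semiring.Exp semiring public using (_^_)
  open import Algebra.Properties.Semiring.Mult semiring public
    using () renaming (_×_ to _·_)

  infix 4 2^_≤ℕ_ xc[_]≡_

  fromℕ : ℕ → ℝ
  fromℕ n = n · 1#

  -- t = 2 ^ ((k - m) / q), the denominator-free form of t ^ q = 2 ^ (k - m).

  IsRational2^ : (k m q : ℕ) → Pred ℝ 0ℓ
  IsRational2^ k m q t = 0# ≤ t × fromℕ 2 ^ m * t ^ q ≈ fromℕ 2 ^ k

  -- z = 2 ^ y, as the supremum of the powers 2 ^ s over rational s ≤ y.

  Is2^ : ℝ → Pred ℝ 0ℓ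
  Is2^ y = IsSupremum λ t →
    ∃[ k ] ∃[ m ] ∃[ q ] 1 ℕ.≤ q
      × fromℕ k ≤ fromℕ m + fromℕ q * y
      × IsRational2^ k m q t

  2^_≤ℕ_ : ℝ → ℕ → Set
  2^ y ≤ℕ r = ∃[ z ] Is2^ y z × z ≤ fromℕ r

  Point : ℕ → Set
  Point d = Vector ℝ d

  Matrix : ℕ → ℕ → Set
  Matrix m n = Fin m → Point n

  _*ᵥ_ : ∀ {m n} → Matrix m n → Point n → Point m
  (A *ᵥ x) i = sum (λ j → A i j * x j)

  conv : ∀ {d} → Pred (Point d) 0ℓ → Pred (Point d) 0ℓ
  conv {d} S x =
    ∃[ k ] Σ[ p ∈ (Fin k → Point d) ] Σ[ w ∈ (Fin k → ℝ) ]
      (∀ i → S (p i))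
      × (∀ i → 0# ≤ w i)
      × sum w ≈ 1#
      × (∀ j → x j ≈ sum (λ i → w i * p i j))

  -- A system with a equalities and r inequalities in d + k variables.

  record LinearSystem (d k a r : ℕ) : Set where
    field
      E⁼ : Matrix a d
      F⁼ : Matrix a k
      g⁼ : Point a
      E≤ : Matrix r d
      F≤ : Matrix r k
      g≤ : Point r

    Satisfies : Point d → Point k → Set
    Satisfies x y =
      (∀ i → (E⁼ *ᵥ x) i + (F⁼ *ᵥ y) i ≈ g⁼ i)
      × (∀ i → (E≤ *ᵥ x) i + (F≤ *ᵥ y) i ≤ g≤ i)

  IsEF : ∀ {d k a r} → Pred (Point d) 0ℓ → LinearSystem d k a r → Set
  IsEF P sys = ∀ x → P x ⇔ (∃[ y ] LinearSystem.Satisfies sys x y)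

  HasEFOfSize : ∀ {d} → Pred (Point d) 0ℓ → ℕ → Set
  HasEFOfSize {d} P r =
    ∃[ k ] ∃[ a ] Σ[ sys ∈ LinearSystem d k a r ] IsEF P sys

  -- xc(P) = r.  A relation, since a minimum of a nonempty set of naturals is
  -- not computable in general.

  xc[_]≡_ : ∀ {d} → Pred (Point d) 0ℓ → ℕ → Set
  xc[ P ]≡ r = HasEFOfSize P r × (∀ s → HasEFOfSize P s → r ℕ.≤ s)

  χ : ∀ {d} → Subset d → Point d
  χ F e = if lookup F e then 1# else 0#

  CUT : ∀ n → Pred (Point ∣E n ∣) 0ℓ
  CUT n = conv λ x → Σ[ X ∈ Subset n ] (∀ e → x e ≈ χ (δ X) e)

  -- An n × n matrix is a point of dimension n * n, with entry (i , j) at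
  -- coordinate combine i j.

  COR : ∀ n → Pred (Point (n ℕ.* n)) 0ℓ
  COR n = conv λ x → Σ[ b ∈ Point n ]
    (∀ i → b i ≈ 0# ⊎ b i ≈ 1#) × (∀ i j → x (combine i j) ≈ b i * b j)

{-# OPTIONS --safe #-}

-- Fix an extended formulation of COR(n) with r inequalities and lift every vertex bbᵀ to a
-- feasible point p_b.  For a ⊆ [n] the inequality ⟨2 diag(a) - aaᵀ, Y⟩ ≤ 1 is valid for COR(n),
-- with slack (1 - |a ∩ b|)² at bbᵀ; let F_a be the face of the formulation on which it is tight.
-- To inequality i attach the rectangle A_i × B_i, where A_i is the set of a such that i is
-- tight on F_a, and B_i the set of b such that i is strict at p_b.  No rectangle contains a
-- pair with |a ∩ b| = 1, since then p_b ∈ F_a.  Every disjoint pair (a , b) is covered: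
-- otherwise each inequality tight at a relative interior point z of F_a would be tight at p_b,
-- and the segment from p_b to z could be prolonged beyond z, violating the valid inequality.
-- By the argument of Kaibel and Weltge, a rectangle without pairs with |a ∩ b| = 1 contains at
-- most 2ⁿ of the 3ⁿ disjoint pairs, so r ≥ (3/2)ⁿ ≥ 2^(n/2).
-- CUT(n+1) and COR(n) are linear images of each other, so their formulations have equal sizes.

module Submission where

open import Defs
import Algebra.Properties.CommutativeSemiring.Exp as Exp
import Algebra.Properties.Ring as RingProperties
import Algebra.Properties.Semiring.Mult as Mult
import Algebra.Properties.Semiring.Mult.TCOptimised as Mult′
import Algebra.Properties.Semiring.Sum as Sum
import Algebra.Solver.Ring as RingSolver
open import Algebra.Solver.Ring.AlmostCommutativeRing using (fromCommutativeRing; _-Raw-AlmostCommutative⟶_)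
open import Axiom.ExcludedMiddle using (ExcludedMiddle)
open import Data.Bool using (Bool; true; false; if_then_else_; _∧_; _∨_; _xor_; T)
import Data.Bool.Properties as Bool
open import Data.Empty using (⊥-elim)
open import Data.Fin as Fin using (Fin; zero; suc; _↑ˡ_; _↑ʳ_; combine; remQuot; finToFun; funToFin)
import Data.Fin.Properties as Fin
open import Data.Fin.Subset using (Subset)
open import Data.Integer as ℤ using (ℤ; +_; -[1+_]; _⊖_)
import Data.Integer.Properties as ℤ
open import Data.List.Membership.Propositional.Properties using (∈-filter⁺; ∈-cartesianProduct⁺; ∈-allFin)
open import Data.List.Relation.Unary.Any using (index)
open import Data.List.Relation.Unary.Any.Properties using (lookup-index)
open import Data.Maybe using (Maybe; just; nothing)
open import Data.Nat as ℕ using (ℕ; zero; suc)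
import Data.Nat.Properties as ℕ
open import Data.Nat.Tactic.RingSolver using (solve-∀)
open import Data.Product using (_×_; _,_; proj₁; proj₂; ∃; ∃-syntax; Σ-syntax)
open import Data.Sum using (_⊎_; inj₁; inj₂)
open import Data.Vec using ([]; _∷_; lookup; tabulate)
open import Data.Vec.Functional using (_++_)
import Data.Vec.Functional.Properties as Vector
open import Data.Vec.Functional.Relation.Unary.All.Properties using (++⁺; ++⁻)
open import Data.Vec.Properties using (lookup∘tabulate; tabulate∘lookup; tabulate-cong)
open import Function using (_∘_; _⇔_; mk⇔; Equivalence; Inverse)
open import Level using (0ℓ)
open import Relation.Binary using (IsTotalOrder; Poset; tri<; tri≈; tri>)
open import Relation.Binary.PropositionalEquality as ≡ using (_≡_; _≢_)
import Relation.Binary.Reasoning.PartialOrder as PosetReasoning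
open import Relation.Nullary using (¬_; yes; no)
open import Relation.Nullary.Decidable using (decidable-stable; fromWitness; isYes; toWitness)
open import Relation.Unary using (Pred)

open Sum ℕ.+-*-semiring using () renaming (sum to sumℕ)

-- A ring solver for the reals with integer coefficients

module ℤSolver (R : RealNumbers) where
  open RealNumbers R hiding (zero)
  open Mult′ semiring renaming (_×_ to _·′_)
  open RingProperties ring using (-0#≈0#; -‿+-comm; -‿distribˡ-*; -‿distribʳ-*; -‿involutive)
  open import Relation.Binary.Reasoning.Setoid setoid

  -- The optimised multiple makes the numerals 1 and 2 evaluate definitionally to `1#` and
  -- `1# + 1#`, so solved equations match their goals without conversion.
  ⟦_⟧ : ℤ → Carrier
  ⟦ + n ⟧      = n ·′ 1#
  ⟦ -[1+ n ] ⟧ = - (suc n ·′ 1#)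

  ⟦⟧-neg : ∀ i → ⟦ ℤ.- i ⟧ ≈ - ⟦ i ⟧
  ⟦⟧-neg (+ zero)   = sym -0#≈0#
  ⟦⟧-neg (+ suc n)  = refl
  ⟦⟧-neg -[1+ n ]   = sym (-‿involutive _)

  ⟦⟧-⊖ : ∀ m n → ⟦ m ⊖ n ⟧ ≈ m ·′ 1# - n ·′ 1#
  ⟦⟧-⊖ zero zero = sym (-‿inverseʳ 0#)
  ⟦⟧-⊖ zero (suc n) = sym (+-identityˡ _)
  ⟦⟧-⊖ (suc m) zero = sym (trans (+-congˡ -0#≈0#) (+-identityʳ _))
  ⟦⟧-⊖ (suc m) (suc n) = begin
    ⟦ suc m ⊖ suc n ⟧                   ≡⟨ ≡.cong ⟦_⟧ (ℤ.[1+m]⊖[1+n]≡m⊖n m n) ⟩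
    ⟦ m ⊖ n ⟧                           ≈⟨ ⟦⟧-⊖ m n ⟩
    a - b                               ≈⟨ +-congʳ (+-identityˡ a) ⟨
    0# + a - b                          ≈⟨ +-congʳ (+-congʳ (-‿inverseʳ 1#)) ⟨
    1# - 1# + a - b                     ≈⟨ +-congʳ (+-congʳ (+-comm _ _)) ⟩
    - 1# + 1# + a - b                   ≈⟨ +-congʳ (+-assoc _ _ _) ⟩
    - 1# + (1# + a) - b                 ≈⟨ +-congʳ (+-comm _ _) ⟩
    1# + a + - 1# - b                   ≈⟨ +-assoc _ _ _ ⟩
    1# + a + (- 1# - b)                 ≈⟨ +-cong (1+× m 1#) (trans (-‿cong (1+× n 1#)) (sym (-‿+-comm _ _))) ⟨
    suc m ·′ 1# - suc n ·′ 1#           ∎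
    where
    a = m ·′ 1#
    b = n ·′ 1#

  ⟦⟧-+ : ∀ i j → ⟦ i ℤ.+ j ⟧ ≈ ⟦ i ⟧ + ⟦ j ⟧
  ⟦⟧-+ (+ m)    (+ n)    = ×-homo-+ 1# m n
  ⟦⟧-+ (+ m)    -[1+ n ] = ⟦⟧-⊖ m (suc n)
  ⟦⟧-+ -[1+ m ] (+ n)    = trans (⟦⟧-⊖ n (suc m)) (+-comm _ _)
  ⟦⟧-+ -[1+ m ] -[1+ n ] = begin
    - (suc (suc (m ℕ.+ n)) ·′ 1#)           ≡⟨ ≡.cong (λ k → - (suc k ·′ 1#)) (ℕ.+-suc m n) ⟨
    - ((suc m ℕ.+ suc n) ·′ 1#)             ≈⟨ -‿cong (×-homo-+ 1# (suc m) (suc n)) ⟩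
    - (suc m ·′ 1# + suc n ·′ 1#)           ≈⟨ -‿+-comm _ _ ⟨
    - (suc m ·′ 1#) + - (suc n ·′ 1#)       ∎

  ⟦⟧-*-pos : ∀ m n → ⟦ + m ℤ.* + n ⟧ ≈ ⟦ + m ⟧ * ⟦ + n ⟧
  ⟦⟧-*-pos m n = trans (reflexive (≡.cong ⟦_⟧ (≡.sym (ℤ.pos-* m n)))) (×1-homo-* m n)

  ⟦⟧-* : ∀ i j → ⟦ i ℤ.* j ⟧ ≈ ⟦ i ⟧ * ⟦ j ⟧
  ⟦⟧-* (+ m)    (+ n)    = ⟦⟧-*-pos m n
  ⟦⟧-* (+ m)    -[1+ n ] = begin
    ⟦ + m ℤ.* -[1+ n ] ⟧          ≡⟨ ≡.cong ⟦_⟧ (ℤ.neg-distribʳ-* (+ m) (+ suc n)) ⟨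
    ⟦ ℤ.- (+ m ℤ.* + suc n) ⟧     ≈⟨ ⟦⟧-neg (+ m ℤ.* + suc n) ⟩
    - ⟦ + m ℤ.* + suc n ⟧         ≈⟨ -‿cong (⟦⟧-*-pos m (suc n)) ⟩
    - (⟦ + m ⟧ * ⟦ + suc n ⟧)     ≈⟨ -‿distribʳ-* _ _ ⟩
    ⟦ + m ⟧ * - ⟦ + suc n ⟧       ∎
  ⟦⟧-* -[1+ m ] (+ n)    = begin
    ⟦ -[1+ m ] ℤ.* + n ⟧          ≡⟨ ≡.cong ⟦_⟧ (ℤ.neg-distribˡ-* (+ suc m) (+ n)) ⟨
    ⟦ ℤ.- (+ suc m ℤ.* + n) ⟧     ≈⟨ ⟦⟧-neg (+ suc m ℤ.* + n) ⟩
    - ⟦ + suc m ℤ.* + n ⟧         ≈⟨ -‿cong (⟦⟧-*-pos (suc m) n) ⟩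
    - (⟦ + suc m ⟧ * ⟦ + n ⟧)     ≈⟨ -‿distribˡ-* _ _ ⟩
    - ⟦ + suc m ⟧ * ⟦ + n ⟧       ∎
  ⟦⟧-* -[1+ m ] -[1+ n ] = begin
    ⟦ + suc m ℤ.* + suc n ⟧       ≈⟨ ⟦⟧-*-pos (suc m) (suc n) ⟩
    x * y                         ≈⟨ -‿involutive _ ⟨
    - - (x * y)                   ≈⟨ -‿cong (-‿distribʳ-* _ _) ⟩
    - (x * - y)                   ≈⟨ -‿distribˡ-* _ _ ⟩
    - x * - y                     ∎
    where
    x = suc m ·′ 1#
    y = suc n ·′ 1#

  morphism : ℤ.+-*-rawRing -Raw-AlmostCommutative⟶ fromCommutativeRing commutativeRing
  morphism = record
    { ⟦_⟧    = ⟦_⟧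
    ; +-homo = ⟦⟧-+
    ; *-homo = ⟦⟧-*
    ; -‿homo = ⟦⟧-neg
    ; 0-homo = refl
    ; 1-homo = refl
    }

  -- Only integers are compared, so normal forms are computed without deciding equality of reals.
  coefficientEquality : ∀ i j → Maybe (⟦ i ⟧ ≈ ⟦ j ⟧)
  coefficientEquality i j with i ℤ.≟ j
  ... | yes i≡j = just (reflexive (≡.cong ⟦_⟧ i≡j))
  ... | no _    = nothing

  open RingSolver _ _ morphism coefficientEquality public
    using (solve; _:=_; _:+_; _:*_; _:-_; :-_; con)

-- Arithmetic of the ordered field

module OrderedField (R : RealNumbers) where
  open Polytopes R public hiding (zero)
  open ℤSolver R public using (solve; _:=_; _:+_; _:*_; _:-_; :-_; con)
  open Mult semiring public using (×-homo-+; ×1-homo-*)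
  open Exp commutativeSemiring public
    using (^-congˡ; ^-homo-*; ^-distrib-*)
  open Sum semiring public
    using (sum-cong-≋; ∑-distrib-+; ∑-comm; *-distribˡ-sum; *-distribʳ-sum; sum-replicate-zero)
  open RingProperties ring public using (-0#≈0#)
  open IsTotalOrder isTotalOrder public
    using (antisym; total; ≤-respʳ-≈; ≤-respˡ-≈)
    renaming (refl to ≤-refl; trans to ≤-trans; reflexive to ≤-reflexive)

  poset : Poset 0ℓ 0ℓ 0ℓ
  poset = record { isPartialOrder = IsTotalOrder.isPartialOrder isTotalOrder }

  module ≤-Reasoning = PosetReasoning poset

  +-mono-≤ : ∀ {x y u v} → x ≤ y → u ≤ v → x + u ≤ y + v
  +-mono-≤ {x} {y} {u} {v} x≤y u≤v = begin
    x + u ≤⟨ +-monoʳ-≤ x u≤v ⟩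
    x + v ≈⟨ +-comm x v ⟩
    v + x ≤⟨ +-monoʳ-≤ v x≤y ⟩
    v + y ≈⟨ +-comm v y ⟩
    y + v ∎
    where open ≤-Reasoning

  x≤y⇒0≤y-x : ∀ {x y} → x ≤ y → 0# ≤ y - x
  x≤y⇒0≤y-x {x} {y} x≤y = begin
    0#       ≈⟨ -‿inverseˡ x ⟨
    - x + x  ≤⟨ +-monoʳ-≤ (- x) x≤y ⟩
    - x + y  ≈⟨ +-comm _ _ ⟩
    y - x    ∎
    where open ≤-Reasoning

  0≤y-x⇒x≤y : ∀ {x y} → 0# ≤ y - x → x ≤ y
  0≤y-x⇒x≤y {x} {y} 0≤y-x = begin
    x           ≈⟨ +-identityʳ x ⟨
    x + 0#      ≤⟨ +-monoʳ-≤ x 0≤y-x ⟩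
    x + (y - x) ≈⟨ solve 2 (λ x y → x :+ (y :- x) := y) refl x y ⟩
    y           ∎
    where open ≤-Reasoning

  +-nonNeg : ∀ {x y} → 0# ≤ x → 0# ≤ y → 0# ≤ x + y
  +-nonNeg 0≤x 0≤y = ≤-respˡ-≈ (+-identityˡ 0#) (+-mono-≤ 0≤x 0≤y)

  *-monoˡ-≤-nonNeg : ∀ {a x y} → 0# ≤ a → x ≤ y → a * x ≤ a * y
  *-monoˡ-≤-nonNeg {a} {x} {y} 0≤a x≤y = 0≤y-x⇒x≤y (≤-respʳ-≈
    (solve 3 (λ a x y → a :* (y :- x) := a :* y :- a :* x) refl a x y)
    (*-nonNeg 0≤a (x≤y⇒0≤y-x x≤y)))

  *-monoʳ-≤-nonNeg : ∀ {a x y} → 0# ≤ a → x ≤ y → x * a ≤ y * a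
  *-monoʳ-≤-nonNeg 0≤a x≤y =
    ≤-respʳ-≈ (*-comm _ _) (≤-respˡ-≈ (*-comm _ _) (*-monoˡ-≤-nonNeg 0≤a x≤y))

  x≤0⇒0≤-x : ∀ {x} → x ≤ 0# → 0# ≤ - x
  x≤0⇒0≤-x x≤0 = ≤-respʳ-≈ (+-identityˡ _) (x≤y⇒0≤y-x x≤0)

  square-nonNeg : ∀ x → 0# ≤ x * x
  square-nonNeg x with total 0# x
  ... | inj₁ 0≤x = *-nonNeg 0≤x 0≤x
  ... | inj₂ x≤0 = ≤-respʳ-≈ (solve 1 (λ x → (:- x) :* (:- x) := x :* x) refl x)
    (*-nonNeg (x≤0⇒0≤-x x≤0) (x≤0⇒0≤-x x≤0))

  0≤1 : 0# ≤ 1#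
  0≤1 = ≤-respʳ-≈ (*-identityˡ 1#) (square-nonNeg 1#)

  0<1 : 0# < 1#
  0<1 = 0≤1 , 0≉1

  ≰⇒≥ : ∀ {x y} → ¬ (x ≤ y) → y ≤ x
  ≰⇒≥ {x} {y} x≰y with total x y
  ... | inj₁ x≤y = ⊥-elim (x≰y x≤y)
  ... | inj₂ y≤x = y≤x

  <⇒≱ : ∀ {x y} → x < y → ¬ (y ≤ x)
  <⇒≱ (x≤y , x≉y) y≤x = x≉y (antisym x≤y y≤x)

  0≤fromℕ : ∀ n → 0# ≤ fromℕ n
  0≤fromℕ zero    = ≤-refl
  0≤fromℕ (suc n) = +-nonNeg 0≤1 (0≤fromℕ n)

  fromℕ-+ : ∀ m n → fromℕ (m ℕ.+ n) ≈ fromℕ m + fromℕ n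
  fromℕ-+ = ×-homo-+ 1#

  fromℕ-* : ∀ m n → fromℕ (m ℕ.* n) ≈ fromℕ m * fromℕ n
  fromℕ-* = ×1-homo-*

  fromℕ-^ : ∀ m n → fromℕ (m ℕ.^ n) ≈ fromℕ m ^ n
  fromℕ-^ m zero    = +-identityʳ 1#
  fromℕ-^ m (suc n) = trans (fromℕ-* m (m ℕ.^ n)) (*-congˡ (fromℕ-^ m n))

  fromℕ-mono-≤ : ∀ {m n} → m ℕ.≤ n → fromℕ m ≤ fromℕ n
  fromℕ-mono-≤ {n = n} ℕ.z≤n = 0≤fromℕ n
  fromℕ-mono-≤ (ℕ.s≤s m≤n)   = +-monoʳ-≤ 1# (fromℕ-mono-≤ m≤n)

  fromℕ-cancel-≤ : ∀ {m n} → fromℕ m ≤ fromℕ n → m ℕ.≤ n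
  fromℕ-cancel-≤ {m} {n} m≤n with m ℕ.≤? n
  ... | yes p = p
  -- Otherwise `suc n` is at most `m`, so `fromℕ (suc n) ≤ fromℕ n`, which says 1 ≤ 0.
  ... | no  m≰n = ⊥-elim (<⇒≱ 0<1 (begin
    1#                        ≈⟨ solve 2 (λ a b → a := (a :+ b) :- b) refl 1# (fromℕ n) ⟩
    fromℕ (suc n) - fromℕ n   ≈⟨ +-comm _ _ ⟩
    - fromℕ n + fromℕ (suc n) ≤⟨ +-monoʳ-≤ _ (≤-trans (fromℕ-mono-≤ (ℕ.≰⇒> m≰n)) m≤n) ⟩
    - fromℕ n + fromℕ n       ≈⟨ -‿inverseˡ _ ⟩
    0#                        ∎))
    where open ≤-Reasoning

  sum-mono-≤ : ∀ {n} {f g : Fin n → ℝ} → (∀ i → f i ≤ g i) → sum f ≤ sum g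
  sum-mono-≤ {zero}  f≤g = ≤-refl
  sum-mono-≤ {suc n} f≤g = +-mono-≤ (f≤g zero) (sum-mono-≤ (f≤g ∘ suc))

  sum-nonNeg : ∀ {n} {f : Fin n → ℝ} → (∀ i → 0# ≤ f i) → 0# ≤ sum f
  sum-nonNeg {n} 0≤f = ≤-respˡ-≈ (sum-replicate-zero n) (sum-mono-≤ 0≤f)

  -- `y ≈ x * (y * y)` is a product of `x` and a square.
  inverse-nonNeg : ∀ {x y} → 0# ≤ x → x * y ≈ 1# → 0# ≤ y
  inverse-nonNeg {x} {y} 0≤x xy≈1 = ≤-respʳ-≈
    (trans (sym (*-assoc x y y)) (trans (*-congʳ xy≈1) (*-identityˡ y)))
    (*-nonNeg 0≤x (square-nonNeg y))

  *-cancelˡ-≤-pos : ∀ {a x y} → 0# < a → a * x ≤ a * y → x ≤ y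
  *-cancelˡ-≤-pos {a} {x} {y} (0≤a , 0≉a) ax≤ay with inverse a (0≉a ∘ sym)
  ... | b , ab≈1 = ≤-respʳ-≈ (cancel y) (≤-respˡ-≈ (cancel x)
        (*-monoˡ-≤-nonNeg (inverse-nonNeg 0≤a ab≈1) ax≤ay))
    where
    cancel : ∀ z → b * (a * z) ≈ z
    cancel z = trans (sym (*-assoc b a z))
      (trans (*-congʳ (trans (*-comm b a) ab≈1)) (*-identityˡ z))

  ^-nonNeg : ∀ {x} n → 0# ≤ x → 0# ≤ x ^ n
  ^-nonNeg zero    0≤x = 0≤1
  ^-nonNeg (suc n) 0≤x = *-nonNeg 0≤x (^-nonNeg n 0≤x)

  ^-mono-≤ : ∀ {x y} n → 0# ≤ x → x ≤ y → x ^ n ≤ y ^ n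
  ^-mono-≤ zero    0≤x x≤y = ≤-refl
  ^-mono-≤ (suc n) 0≤x x≤y = ≤-trans
    (*-monoʳ-≤-nonNeg (^-nonNeg n 0≤x) x≤y)
    (*-monoˡ-≤-nonNeg (≤-trans 0≤x x≤y) (^-mono-≤ n 0≤x x≤y))

-- Linear forms, linear images and formulations of convex hulls

module LinearForms (R : RealNumbers) where
  open OrderedField R
  open import Relation.Binary.Reasoning.Setoid setoid

  infix 4 _≋_

  _≋_ : ∀ {d} → Point d → Point d → Set
  x ≋ y = ∀ j → x j ≈ y j

  unit : ∀ {d} → Fin d → Point d
  unit zero    zero    = 1#
  unit zero    (suc j) = 0#
  unit (suc i) zero    = 0#
  unit (suc i) (suc j) = unit i j

  sum-zero : ∀ {n} {f : Fin n → ℝ} → (∀ i → f i ≈ 0#) → sum f ≈ 0#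
  sum-zero {n} f≈0 = trans (sum-cong-≋ f≈0) (sum-replicate-zero n)

  sum-unit : ∀ {d} (i : Fin d) (x : Point d) → sum (λ j → unit i j * x j) ≈ x i
  sum-unit {suc d} zero x = trans (+-cong (*-identityˡ _) (sum-zero {d} λ j → zeroˡ _)) (+-identityʳ _)
  sum-unit (suc i) x = trans (+-cong (zeroˡ _) (sum-unit i (x ∘ suc))) (+-identityˡ _)

  unit-sym : ∀ {d} (i j : Fin d) → unit i j ≈ unit j i
  unit-sym zero    zero    = refl
  unit-sym zero    (suc j) = refl
  unit-sym (suc i) zero    = refl
  unit-sym (suc i) (suc j) = unit-sym i j

  0≤unit : ∀ {d} (i j : Fin d) → 0# ≤ unit i j
  0≤unit zero    zero    = 0≤1
  0≤unit zero    (suc j) = ≤-refl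
  0≤unit (suc i) zero    = ≤-refl
  0≤unit (suc i) (suc j) = 0≤unit i j

  -- Evaluation and coefficients are kept side by side: proofs compute with the first in whatever
  -- shape is convenient, while a `LinearSystem` asks for the second.
  record Form (d : ℕ) : Set where
    constructor form
    field
      ⟦_⟧     : Point d → ℝ
      coeff   : Point d
      correct : ∀ x → sum (λ j → coeff j * x j) ≈ ⟦_⟧ x

    respects : ∀ {x y} → x ≋ y → ⟦_⟧ x ≈ ⟦_⟧ y
    respects {x} {y} x≋y = trans (sym (correct x))
      (trans (sum-cong-≋ λ j → *-congˡ (x≋y j)) (correct y))

    -- Interchange of two finite sums. The weights are arbitrary reals; `linear` is later applied
    -- with a negative one.
    combination : ∀ {k} (w : Fin k → ℝ) (p : Fin k → Point d) →
                  ⟦_⟧ (λ j → sum (λ i → w i * p i j)) ≈ sum (λ i → w i * ⟦_⟧ (p i))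
    combination {k} w p = begin
      ⟦_⟧ (λ j → sum (λ i → w i * p i j))                    ≈⟨ correct _ ⟨
      sum (λ j → coeff j * sum (λ i → w i * p i j))          ≈⟨ sum-cong-≋ {d} (λ j → *-distribˡ-sum {k} (coeff j) _) ⟩
      sum (λ j → sum (λ i → coeff j * (w i * p i j)))        ≈⟨ ∑-comm {d} {k} _ ⟩
      sum (λ i → sum (λ j → coeff j * (w i * p i j)))
        ≈⟨ sum-cong-≋ {k} (λ i → sum-cong-≋ {d} λ j → solve 3 (λ a b c → a :* (b :* c) := b :* (a :* c)) refl _ _ _) ⟩
      sum (λ i → sum (λ j → w i * (coeff j * p i j)))        ≈⟨ sum-cong-≋ {k} (λ i → *-distribˡ-sum {d} (w i) _) ⟨
      sum (λ i → w i * sum (λ j → coeff j * p i j))          ≈⟨ sum-cong-≋ (λ i → *-congˡ (correct (p i))) ⟩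
      sum (λ i → w i * ⟦_⟧ (p i))                            ∎

  open Form public using (⟦_⟧)

  infixl 6 _⊕_
  infixl 7 _⊛_

  coord : ∀ {d} → Fin d → Form d
  coord i = form (λ x → x i) (unit i) (sum-unit i)

  null : ∀ {d} → Form d
  null {d} = form (λ _ → 0#) (λ _ → 0#) (λ x → sum-zero {d} λ j → zeroˡ _)

  _⊕_ : ∀ {d} → Form d → Form d → Form d
  form f a fa ⊕ form g b gb = form (λ x → f x + g x) (λ j → a j + b j) λ x → begin
    sum (λ j → (a j + b j) * x j)               ≈⟨ sum-cong-≋ (λ j → distribʳ (x j) (a j) (b j)) ⟩
    sum (λ j → a j * x j + b j * x j)           ≈⟨ ∑-distrib-+ (λ j → a j * x j) (λ j → b j * x j) ⟩
    sum (λ j → a j * x j) + sum (λ j → b j * x j) ≈⟨ +-cong (fa x) (gb x) ⟩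
    f x + g x                                   ∎

  _⊛_ : ∀ {d} → ℝ → Form d → Form d
  c ⊛ form f a fa = form (λ x → c * f x) (λ j → c * a j) λ x → begin
    sum (λ j → c * a j * x j)     ≈⟨ sum-cong-≋ (λ j → *-assoc c (a j) (x j)) ⟩
    sum (λ j → c * (a j * x j))   ≈⟨ *-distribˡ-sum c (λ j → a j * x j) ⟨
    c * sum (λ j → a j * x j)     ≈⟨ *-congˡ (fa x) ⟩
    c * f x                       ∎

  ⨁ : ∀ {n d} → (Fin n → Form d) → Form d
  ⨁ {n} f = form (λ x → sum (λ i → ⟦ f i ⟧ x)) (λ j → sum (λ i → Form.coeff (f i) j)) λ x → begin
    sum (λ j → sum (λ i → Form.coeff (f i) j) * x j)    ≈⟨ sum-cong-≋ (λ j → *-distribʳ-sum (x j) (λ i → Form.coeff (f i) j)) ⟩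
    sum (λ j → sum (λ i → Form.coeff (f i) j * x j))    ≈⟨ ∑-comm (λ j i → Form.coeff (f i) j * x j) ⟩
    sum (λ i → sum (λ j → Form.coeff (f i) j * x j))    ≈⟨ sum-cong-≋ (λ i → Form.correct (f i) x) ⟩
    sum (λ i → ⟦ f i ⟧ x)                               ∎

  pullback : ∀ {d e} → (Fin e → Fin d) → Point e → Form d
  pullback ι c = ⨁ λ j → c j ⊛ coord (ι j)

  LinearMap : ℕ → ℕ → Set
  LinearMap e d = Fin d → Form e

  apply : ∀ {e d} → LinearMap e d → Point e → Point d
  apply M y j = ⟦ M j ⟧ y

  IsImage : ∀ {e d} → LinearMap e d → Pred (Point e) 0ℓ → Pred (Point d) 0ℓ → Set
  IsImage M Q P = ∀ x → P x ⇔ (∃[ y ] Q y × x ≋ apply M y)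

  -- A linear map commutes with convex combinations, so the weights are kept and each generator is
  -- replaced by its image or by a chosen preimage.
  conv-image : ∀ {e d} (M : LinearMap e d) {S : Pred (Point e) 0ℓ} {T : Pred (Point d) 0ℓ} →
               (∀ u → S u → ∃[ t ] T t × t ≋ apply M u) →
               (∀ t → T t → ∃[ u ] S u × t ≋ apply M u) →
               IsImage M (conv S) (conv T)
  conv-image M {S} {T} S⇒T T⇒S x = mk⇔ to from
    where
    to : conv T x → ∃[ y ] conv S y × x ≋ apply M y
    to (k , p , w , Tp , 0≤w , ∑w , x≋) =
      (λ j → sum λ i → w i * u i j)
      , (k , u , w , (λ i → proj₁ (proj₂ (T⇒S _ (Tp i)))) , 0≤w , ∑w , λ j → refl)
      , λ j → trans (x≋ j) (trans (sum-cong-≋ λ i → *-congˡ (proj₂ (proj₂ (T⇒S _ (Tp i))) j))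
          (sym (Form.combination (M j) w u)))
      where
      u = λ i → proj₁ (T⇒S _ (Tp i))

    from : (∃[ y ] conv S y × x ≋ apply M y) → conv T x
    from (y , (k , p , w , Sp , 0≤w , ∑w , y≋) , x≋) =
      k , (λ i → proj₁ (S⇒T _ (Sp i))) , w , (λ i → proj₁ (proj₂ (S⇒T _ (Sp i)))) , 0≤w , ∑w
      , λ j → trans (x≋ j) (trans (Form.respects (M j) y≋) (trans (Form.combination (M j) w p)
          (sum-cong-≋ λ i → *-congˡ (sym (proj₂ (proj₂ (S⇒T _ (Sp i))) j)))))

  record Row (d k : ℕ) : Set where
    constructor row
    field
      onX : Form d
      onY : Form k
      rhs : ℝ

    lhs : Point d → Point k → ℝ
    lhs x y = ⟦ onX ⟧ x + ⟦ onY ⟧ y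

    Equation Inequality : Point d → Point k → Set
    Equation   x y = lhs x y ≈ rhs
    Inequality x y = lhs x y ≤ rhs

    lhs-correct : ∀ x y → sum (λ j → Form.coeff onX j * x j) + sum (λ j → Form.coeff onY j * y j) ≈ lhs x y
    lhs-correct x y = +-cong (Form.correct onX x) (Form.correct onY y)

  open Row public using (Equation; Inequality)

  hasEF-of-rows : ∀ {d k a r} {P : Pred (Point d) 0ℓ} (eqs : Fin a → Row d k) (ineqs : Fin r → Row d k) →
                  (∀ x → P x ⇔ (∃[ y ] (∀ i → Equation (eqs i) x y) × (∀ i → Inequality (ineqs i) x y))) →
                  HasEFOfSize P r
  hasEF-of-rows eqs ineqs P⇔ = _ , _ , system , λ x → mk⇔
      (λ Px → let (y , s⁼ , s≤) = Equivalence.to (P⇔ x) Px in y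
        , (λ i → trans (Row.lhs-correct (eqs i) x y) (s⁼ i))
        , (λ i → ≤-respˡ-≈ (sym (Row.lhs-correct (ineqs i) x y)) (s≤ i)))
      (λ (y , s⁼ , s≤) → Equivalence.from (P⇔ x) (y
        , (λ i → trans (sym (Row.lhs-correct (eqs i) x y)) (s⁼ i))
        , (λ i → ≤-respˡ-≈ (Row.lhs-correct (ineqs i) x y) (s≤ i))))
    where
    system : LinearSystem _ _ _ _
    system = record
      { E⁼ = λ i → Form.coeff (Row.onX (eqs i))
      ; F⁼ = λ i → Form.coeff (Row.onY (eqs i))
      ; g⁼ = λ i → Row.rhs (eqs i)
      ; E≤ = λ i → Form.coeff (Row.onX (ineqs i))
      ; F≤ = λ i → Form.coeff (Row.onY (ineqs i))
      ; g≤ = λ i → Row.rhs (ineqs i)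
      }

  -- The equations x = My and the equations for Q do not count towards the size, and the
  -- inequalities are exactly those for Q.
  hasEF-image : ∀ {e d r} (M : LinearMap e d) {Q : Pred (Point e) 0ℓ} {P : Pred (Point d) 0ℓ} →
                IsImage M Q P → HasEFOfSize Q r → HasEFOfSize P r
  hasEF-image {e} {d} {r} M {Q} {P} image (k , a , sys , ef) =
    hasEF-of-rows (graph ++ lift E⁼ F⁼ g⁼) (lift E≤ F≤ g≤) λ x → mk⇔ (to x) (from x)
    where
    open LinearSystem sys

    dot : ∀ {n} → Point n → Point n → ℝ
    dot c y = sum (λ j → c j * y j)

    -- The auxiliary variables are a point of Q followed by those of its own formulation.
    graph : Fin d → Row d (e ℕ.+ k)
    graph j = row (coord j) (- 1# ⊛ pullback (_↑ˡ k) (Form.coeff (M j))) 0#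

    lift : ∀ {m} → Matrix m e → Matrix m k → Point m → Fin m → Row d (e ℕ.+ k)
    lift E F g i = row null (pullback (_↑ˡ k) (E i) ⊕ pullback (e ↑ʳ_) (F i)) (g i)

    graph⁺ : ∀ {s t} → s ≈ t → s + - 1# * t ≈ 0#
    graph⁺ {s} {t} s≈t = trans (+-congʳ s≈t) (solve 1 (λ t → t :+ (:- con (ℤ.+ 1)) :* t := con (ℤ.+ 0)) refl t)

    graph⁻ : ∀ {s t} → s + - 1# * t ≈ 0# → s ≈ t
    graph⁻ {s} {t} eq = trans (solve 2 (λ s t → s := (s :+ (:- con (ℤ.+ 1)) :* t) :+ t) refl s t)
      (trans (+-congʳ eq) (+-identityˡ t))

    to : ∀ x → P x → ∃[ v ] (∀ i → Equation ((graph ++ lift E⁼ F⁼ g⁼) i) x v) × (∀ i → Inequality (lift E≤ F≤ g≤ i) x v)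
    to x Px with Equivalence.to (image x) Px
    ... | y , Qy , x≋My with Equivalence.to (ef y) Qy
    ...   | y′ , s⁼ , s≤ = v
          , ++⁺ (λ ρ → Equation ρ x v) {xs = graph} {ys = lift E⁼ F⁼ g⁼}
              (λ j → graph⁺ (trans (x≋My j) (trans (sym (Form.correct (M j) y)) (sym (onˡ _)))))
              (λ i → trans (+-identityˡ _) (trans (+-cong (onˡ (E⁼ i)) (onʳ (F⁼ i))) (s⁼ i)))
          , λ i → ≤-respˡ-≈ (sym (trans (+-identityˡ _) (+-cong (onˡ (E≤ i)) (onʳ (F≤ i))))) (s≤ i)
          where
          v = y ++ y′
          onˡ : ∀ c → dot c (v ∘ (_↑ˡ k)) ≈ dot c y
          onˡ c = sum-cong-≋ λ j → *-congˡ (reflexive (Vector.lookup-++ˡ y y′ j))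
          onʳ : ∀ c → dot c (v ∘ (e ↑ʳ_)) ≈ dot c y′
          onʳ c = sum-cong-≋ λ j → *-congˡ (reflexive (Vector.lookup-++ʳ y y′ j))

    from : ∀ x → (∃[ v ] (∀ i → Equation ((graph ++ lift E⁼ F⁼ g⁼) i) x v) × (∀ i → Inequality (lift E≤ F≤ g≤ i) x v)) → P x
    from x (v , s⁼ , s≤) with ++⁻ (λ ρ → Equation ρ x v) graph s⁼
    ... | onGraph , onSystem = Equivalence.from (image x)
          ( v ∘ (_↑ˡ k)
          , Equivalence.from (ef _) (v ∘ (e ↑ʳ_)
              , (λ i → trans (sym (+-identityˡ _)) (onSystem i))
              , (λ i → ≤-respˡ-≈ (+-identityˡ _) (s≤ i)))
          , λ j → trans (graph⁻ (onGraph j)) (Form.correct (M j) _))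

  Simplex : ∀ n → Pred (Point n) 0ℓ
  Simplex n y = (∀ i → 0# ≤ y i) × sum y ≈ 1#

  Vertex : ∀ {n d} → (Fin n → Point d) → Pred (Point d) 0ℓ
  Vertex v x = ∃[ i ] x ≋ v i

  simplex-hasEF : ∀ n → HasEFOfSize (Simplex n) n
  simplex-hasEF n = hasEF-of-rows {k = 0} {a = 1}
    (λ _ → row (⨁ coord) null 1#) (λ i → row (- 1# ⊛ coord i) null 0#) λ x → mk⇔
      (λ (0≤x , ∑x) → (λ ()) , (λ _ → trans (+-identityʳ _) ∑x)
        , λ i → 0≤y-x⇒x≤y (≤-respʳ-≈ (negate (x i)) (0≤x i)))
      (λ (y , s⁼ , s≤) → (λ i → ≤-respʳ-≈ (sym (negate (x i))) (x≤y⇒0≤y-x (s≤ i)))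
        , trans (sym (+-identityʳ _)) (s⁼ zero))
    where
    negate : ∀ t → t ≈ 0# - (- 1# * t + 0#)
    negate = solve 1 (λ t → t := con (ℤ.+ 0) :- ((:- con (ℤ.+ 1)) :* t :+ con (ℤ.+ 0))) refl

  sum-unitˡ : ∀ {d} (i : Fin d) (x : Point d) → sum (λ j → x j * unit j i) ≈ x i
  sum-unitˡ i x = trans (sum-cong-≋ λ j → trans (*-comm _ _) (*-congʳ (unit-sym j i))) (sum-unit i x)

  sum-of-unit : ∀ {d} (i : Fin d) → sum (unit i) ≈ 1#
  sum-of-unit i = trans (sum-cong-≋ λ j → sym (*-identityʳ (unit i j))) (sum-unit i λ _ → 1#)

  simplex-conv : ∀ n x → Simplex n x ⇔ conv (Vertex (unit {n})) x
  simplex-conv n x = mk⇔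
    -- A point of the simplex combines the unit vectors with its own coordinates as weights.
    (λ (0≤x , ∑x) → n , unit , x , (λ i → i , λ j → refl) , 0≤x , ∑x , λ j → sym (sum-unitˡ j x))
    λ (k , p , w , Vp , 0≤w , ∑w , x≋) →
      (λ j → ≤-respʳ-≈ (sym (x≋ j)) (sum-nonNeg λ i →
        *-nonNeg (0≤w i) (≤-respʳ-≈ (sym (proj₂ (Vp i) j)) (0≤unit (proj₁ (Vp i)) j))))
      , (begin
        sum x                                        ≈⟨ sum-cong-≋ x≋ ⟩
        sum (λ j → sum (λ i → w i * p i j))          ≈⟨ ∑-comm (λ j i → w i * p i j) ⟩
        sum (λ i → sum (λ j → w i * p i j))          ≈⟨ sum-cong-≋ (λ i → *-distribˡ-sum (w i) (p i)) ⟨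
        sum (λ i → w i * sum (p i))
          ≈⟨ sum-cong-≋ (λ i → *-congˡ (trans (sum-cong-≋ (proj₂ (Vp i))) (sum-of-unit (proj₁ (Vp i))))) ⟩
        sum (λ i → w i * 1#)                         ≈⟨ sum-cong-≋ (λ i → *-identityʳ (w i)) ⟩
        sum w                                        ≈⟨ ∑w ⟩
        1#                                           ∎)

  -- The hull of n points is the image of the simplex under the map sending the i-th unit vector to
  -- `v i`. This supplies the first formulation from which a minimum size can be sought.
  conv-hasEF : ∀ {n d} (v : Fin n → Point d) {T : Pred (Point d) 0ℓ} →
               (∀ i → T (v i)) → (∀ t → T t → ∃[ i ] t ≋ v i) → HasEFOfSize (conv T) n
  conv-hasEF {n} v {T} Tv T⇒v =
    hasEF-image M
      (λ x → let open Equivalence (image x) in mk⇔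
        (λ c → let (y , Sy , eq) = to c in y , Equivalence.from (simplex-conv n y) Sy , eq)
        (λ (y , Δy , eq) → from (y , Equivalence.to (simplex-conv n y) Δy , eq)))
      (simplex-hasEF n)
    where
    M : LinearMap _ _
    M j = ⨁ λ i → v i j ⊛ coord i

    M-unit : ∀ i j → v i j ≈ ⟦ M j ⟧ (unit i)
    M-unit i j = sym (trans (sum-cong-≋ {n} λ l → *-comm _ _) (sum-unit i λ l → v l j))

    image : IsImage M (conv (Vertex unit)) (conv T)
    image = conv-image M {Vertex unit}
      (λ u (i , u≋) → v i , Tv i , λ j → trans (M-unit i j) (Form.respects (M j) (λ l → sym (u≋ l))))
      (λ t Tt → let (i , t≋) = T⇒v t Tt in unit i , (i , λ j → refl {x = unit i j}) , λ j → trans (t≋ j) (M-unit i j))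

-- Cut and correlation polytopes as linear images of each other

xor-cancelˡ : ∀ p q r → (p xor q) xor (p xor r) ≡ q xor r
xor-cancelˡ false q     r = ≡.refl
xor-cancelˡ true  false r = Bool.not-involutive r
xor-cancelˡ true  true  r = ≡.refl

edge-index : ∀ {n} {i j : Fin n} → i Fin.< j → ∃[ e ] edge n e ≡ (i , j)
edge-index {n} {i} {j} i<j = index i,j∈E , ≡.sym (lookup-index i,j∈E)
  where
  i,j∈E = ∈-filter⁺ (λ (i , j) → i Fin.<? j) (∈-cartesianProduct⁺ (∈-allFin i) (∈-allFin j)) i<j

subset : ∀ {n} → Fin (2 ℕ.^ n) → Subset n
subset i = tabulate (Inverse.to Fin.2↔Bool ∘ finToFun i)

subset-surjective : ∀ {n} (X : Subset n) → ∃[ i ] subset i ≡ X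
subset-surjective X = funToFin bits ,
  ≡.trans (tabulate-cong λ j → ≡.trans (≡.cong (Inverse.to Fin.2↔Bool) (Fin.finToFun-funToFin bits j))
    (Inverse.strictlyInverseˡ Fin.2↔Bool (lookup X j)))
    (tabulate∘lookup X)
  where
  bits = Inverse.from Fin.2↔Bool ∘ lookup X

module CutCorrelation (R : RealNumbers) where
  open OrderedField R
  open LinearForms R

  bit : Bool → ℝ
  bit p = if p then 1# else 0#

  bit-01 : ∀ p → bit p ≈ 0# ⊎ bit p ≈ 1#
  bit-01 false = inj₁ refl
  bit-01 true  = inj₂ refl

  01-bit : ∀ {x} → x ≈ 0# ⊎ x ≈ 1# → ∃[ p ] x ≈ bit p
  01-bit (inj₁ x≈0) = false , x≈0
  01-bit (inj₂ x≈1) = true , x≈1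

  -- The only nonlinear term is a product of two bits, which is an entry of a correlation matrix;
  -- this is what makes the passage between cuts and correlations linear.
  bit-xor : ∀ p q → bit (p xor q) ≈ bit p + bit q + - (1# + 1#) * (bit p * bit q)
  bit-xor false q = solve 1 (λ y → y := con (ℤ.+ 0) :+ y :+ (:- con (ℤ.+ 2)) :* (con (ℤ.+ 0) :* y)) refl (bit q)
  bit-xor true false = solve 0 (con (ℤ.+ 1) := con (ℤ.+ 1) :+ con (ℤ.+ 0) :+ (:- con (ℤ.+ 2)) :* (con (ℤ.+ 1) :* con (ℤ.+ 0))) refl
  bit-xor true true = solve 0 (con (ℤ.+ 0) := con (ℤ.+ 1) :+ con (ℤ.+ 1) :+ (:- con (ℤ.+ 2)) :* (con (ℤ.+ 1) :* con (ℤ.+ 1))) refl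

  cut : ∀ {m} → Subset m → Point ∣E m ∣
  cut X = χ (δ X)

  cut-edge : ∀ {m} (X : Subset m) {e u v} → edge m e ≡ (u , v) → cut X e ≡ bit (lookup X u xor lookup X v)
  cut-edge X {e} e≡uv = ≡.cong bit (≡.trans (lookup∘tabulate _ e)
    (≡.cong (λ (i , j) → lookup X i xor lookup X j) e≡uv))

  CutVector : ∀ m → Pred (Point ∣E m ∣) 0ℓ
  CutVector m x = Σ[ X ∈ Subset m ] (∀ e → x e ≈ cut X e)

  cut-hasEF : ∀ m → HasEFOfSize (CUT m) (2 ℕ.^ m)
  cut-hasEF m = conv-hasEF {2 ℕ.^ m} {∣E m ∣} (λ i → cut {m} (subset i)) {CutVector m} (λ i → subset i , λ e → refl)
    λ t (X , t≋) → let (i , i≡X) = subset-surjective X in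
      i , λ e → trans (t≋ e) (reflexive (≡.cong (λ Y → cut Y e) (≡.sym i≡X)))

  module _ {m : ℕ} where
    -- Edges are listed only as increasing pairs. This reads the coordinate of uv in either order
    -- and gives 0 for u = v, as no cut separates a vertex from itself.
    distance : Fin m → Fin m → Form ∣E m ∣
    distance u v with Fin.<-cmp u v
    ... | tri< u<v _ _ = coord (proj₁ (edge-index u<v))
    ... | tri≈ _ _ _   = null
    ... | tri> _ _ v<u = coord (proj₁ (edge-index v<u))

    distance-cut : ∀ X u v → ⟦ distance u v ⟧ (cut X) ≈ bit (lookup X u xor lookup X v)
    distance-cut X u v with Fin.<-cmp u v
    ... | tri< u<v _ _    = reflexive (cut-edge X (proj₂ (edge-index u<v)))
    ... | tri≈ _ ≡.refl _ = reflexive (≡.cong bit (≡.sym (Bool.xor-same (lookup X u))))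
    ... | tri> _ _ v<u    = reflexive (≡.trans (cut-edge X (proj₂ (edge-index v<u)))
      (≡.cong bit (Bool.xor-comm (lookup X v) (lookup X u))))

  2≉0 : ¬ (1# + 1# ≈ 0#)
  2≉0 2≈0 = <⇒≱ 0<1 (≤-respʳ-≈ 2≈0 (≤-respˡ-≈ (+-identityʳ 1#) (+-monoʳ-≤ 1# 0≤1)))

  ½ : ℝ
  ½ = proj₁ (inverse (1# + 1#) 2≉0)

  2*½≈1 : (1# + 1#) * ½ ≈ 1#
  2*½≈1 = proj₂ (inverse (1# + 1#) 2≉0)

  module _ {n : ℕ} where
    CorrelationMatrix : Pred (Point (n ℕ.* n)) 0ℓ
    CorrelationMatrix x = Σ[ b ∈ Point n ]
      (∀ i → b i ≈ 0# ⊎ b i ≈ 1#) × (∀ i j → x (combine i j) ≈ b i * b j)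

    -- Membership in X relative to the vertex 0, which is insensitive to complementing X.
    relative : Subset (suc n) → Point n
    relative X i = bit (lookup X zero xor lookup X (suc i))

    -- b_i b_j = (x_0i + x_0j - x_ij) / 2
    toCOR : LinearMap ∣E suc n ∣ (n ℕ.* n)
    toCOR p = let (i , j) = remQuot n p in
      ½ ⊛ (distance zero (suc i) ⊕ distance zero (suc j) ⊕ - 1# ⊛ distance (suc i) (suc j))

    -- x_uv = b_u + b_v - 2 b_u b_v with b_0 = 0
    diagonal : Fin (suc n) → Form (n ℕ.* n)
    diagonal zero    = null
    diagonal (suc i) = coord (combine i i)

    entry : Fin (suc n) → Fin (suc n) → Form (n ℕ.* n)
    entry zero    v       = null
    entry (suc i) zero    = null
    entry (suc i) (suc j) = coord (combine i j)

    toCUT : LinearMap (n ℕ.* n) ∣E suc n ∣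
    toCUT e = let (u , v) = edge (suc n) e in
      diagonal u ⊕ diagonal v ⊕ - (1# + 1#) ⊛ entry u v

    -- The coordinates at 0i and 0j are b and c, and by `xor-cancelˡ` the one at ij is the exclusive
    -- or of these two bits. By `bit-xor` the bracket collapses to 2bc.
    toCOR-cut : ∀ X i j → apply toCOR (cut X) (combine i j) ≈ relative X i * relative X j
    toCOR-cut X i j = begin
      apply toCOR (cut X) (combine i j)
        ≡⟨ ≡.cong (λ (i , j) → ⟦ ½ ⊛ (distance zero (suc i) ⊕ distance zero (suc j) ⊕ - 1# ⊛ distance (suc i) (suc j)) ⟧ (cut X))
             (Fin.remQuot-combine i j) ⟩
      ½ * (⟦ distance zero (suc i) ⟧ (cut X) + ⟦ distance zero (suc j) ⟧ (cut X) + - 1# * ⟦ distance (suc i) (suc j) ⟧ (cut X))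
        ≈⟨ *-congˡ (+-cong (+-cong (distance-cut X zero (suc i)) (distance-cut X zero (suc j)))
             (*-congˡ (trans (distance-cut X (suc i) (suc j)) xor-relative))) ⟩
      ½ * (b + c + - 1# * (b + c + - (1# + 1#) * (b * c)))
        ≈⟨ solve 3 (λ h b c → h :* (b :+ c :+ (:- con (ℤ.+ 1)) :* (b :+ c :+ (:- con (ℤ.+ 2)) :* (b :* c))) := con (ℤ.+ 2) :* h :* (b :* c))
             refl ½ b c ⟩
      (1# + 1#) * ½ * (b * c)
        ≈⟨ trans (*-congʳ 2*½≈1) (*-identityˡ _) ⟩
      b * c ∎
      where
      open import Relation.Binary.Reasoning.Setoid setoid
      b = relative X i
      c = relative X j
      xor-relative : bit (lookup X (suc i) xor lookup X (suc j)) ≈ b + c + - (1# + 1#) * (b * c)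
      xor-relative = trans
        (reflexive (≡.cong bit (≡.sym (xor-cancelˡ (lookup X zero) (lookup X (suc i)) (lookup X (suc j))))))
        (bit-xor (lookup X zero xor lookup X (suc i)) (lookup X zero xor lookup X (suc j)))

    -- An edge uv is cut exactly when u and v differ in their membership relative to the vertex 0.
    -- Then `bit-xor` applies, with the linear terms read from the diagonal since a bit equals its
    -- square.
    toCUT-correlation : ∀ X {y} → (∀ i j → y (combine i j) ≈ relative X i * relative X j) → cut X ≋ apply toCUT y
    toCUT-correlation X {y} y≈ e = trans (reflexive (cut-edge X ≡.refl)) (lemma (proj₁ (edge (suc n) e)) (proj₂ (edge (suc n) e)))
      where
      p = lookup X
      b : Fin (suc n) → ℝ
      b u = bit (p zero xor p u)

      b-zero : b zero ≈ 0#
      b-zero = reflexive (≡.cong bit (Bool.xor-same (p zero)))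

      b-square : ∀ u → b u * b u ≈ b u
      b-square u with p zero xor p u
      ... | false = zeroˡ 0#
      ... | true  = *-identityˡ 1#

      diagonal-b : ∀ u → ⟦ diagonal u ⟧ y ≈ b u
      diagonal-b zero    = sym b-zero
      diagonal-b (suc i) = trans (y≈ i i) (b-square (suc i))

      entry-b : ∀ u v → ⟦ entry u v ⟧ y ≈ b u * b v
      entry-b zero    v       = sym (trans (*-congʳ b-zero) (zeroˡ _))
      entry-b (suc i) zero    = sym (trans (*-congˡ b-zero) (zeroʳ _))
      entry-b (suc i) (suc j) = y≈ i j

      lemma : ∀ u v → bit (p u xor p v) ≈ ⟦ diagonal u ⊕ diagonal v ⊕ - (1# + 1#) ⊛ entry u v ⟧ y
      lemma u v = trans (reflexive (≡.cong bit (≡.sym (xor-cancelˡ (p zero) (p u) (p v)))))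
        (trans (bit-xor (p zero xor p u) (p zero xor p v))
          (sym (+-cong (+-cong (diagonal-b u) (diagonal-b v)) (*-congˡ (entry-b u v)))))

    -- The leading `false` leaves the vertex 0 outside, so membership relative to 0 is plain
    -- membership.
    support : (b : Point n) → (∀ i → b i ≈ 0# ⊎ b i ≈ 1#) → Subset (suc n)
    support b b01 = false ∷ tabulate (λ i → proj₁ (01-bit (b01 i)))

    relative-support : ∀ b (b01 : ∀ i → b i ≈ 0# ⊎ b i ≈ 1#) i → b i ≈ relative (support b b01) i
    relative-support b b01 i = trans (proj₂ (01-bit (b01 i)))
      (reflexive (≡.cong bit (≡.sym (lookup∘tabulate _ i))))

    correlation-of-cut : ∀ X → CorrelationMatrix (apply toCOR (cut X))
    correlation-of-cut X = relative X , (λ i → bit-01 (lookup X zero xor lookup X (suc i))) , toCOR-cut X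

    COR-image : IsImage toCOR (CUT (suc n)) (COR n)
    COR-image = conv-image toCOR {CutVector (suc n)} {CorrelationMatrix}
      (λ u (X , u≋) → _ , correlation-of-cut X , λ p → Form.respects (toCOR p) (λ e → sym (u≋ e)))
      λ t (b , b01 , t≈) → let X = support b b01 in cut X , (X , λ e → refl {x = cut X e}) , λ p →
        let (i , j , ij≡p) = Fin.combine-surjective p in
        trans (≡.subst (λ q → t q ≈ relative X i * relative X j) ij≡p
                (trans (t≈ i j) (*-cong (relative-support b b01 i) (relative-support b b01 j))))
              (≡.subst (λ q → relative X i * relative X j ≈ apply toCOR (cut X) q) ij≡p
                (sym (toCOR-cut X i j)))

    CUT-image : IsImage toCUT (COR n) (CUT (suc n))
    CUT-image = conv-image toCUT {CorrelationMatrix} {CutVector (suc n)}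
      (λ u (b , b01 , u≈) → let X = support b b01 in cut X , (X , λ e → refl {x = cut X e})
        , toCUT-correlation X λ i j → trans (u≈ i j) (*-cong (relative-support b b01 i) (relative-support b b01 j)))
      λ t (X , t≋) → apply toCOR (cut X) , correlation-of-cut X , λ e → trans (t≋ e) (toCUT-correlation X (toCOR-cut X) e)

  CUT⇔COR : ∀ n r → HasEFOfSize (CUT (suc n)) r ⇔ HasEFOfSize (COR n) r
  CUT⇔COR n r = mk⇔ (hasEF-image (toCOR {n}) COR-image) (hasEF-image (toCUT {n}) CUT-image)

-- Counting disjoint pairs covered by rectangles

inner : ∀ {n} → Subset n → Subset n → ℕ
inner []      []      = 0
inner (p ∷ a) (q ∷ b) = (if p ∧ q then 1 else 0) ℕ.+ inner a b

-- At each element a disjoint pair has three patterns: in neither set, only in the first, only in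
-- the second. Summing by this recursion avoids listing the pairs.
disjointSum : ∀ n → (Subset n → Subset n → ℕ) → ℕ
disjointSum zero    f = f [] []
disjointSum (suc n) f =
  disjointSum n (λ a b → f (false ∷ a) (false ∷ b))
  ℕ.+ disjointSum n (λ a b → f (true ∷ a) (false ∷ b))
  ℕ.+ disjointSum n (λ a b → f (false ∷ a) (true ∷ b))

disjointSum-mono : ∀ n {f g} → (∀ a b → inner a b ≡ 0 → f a b ℕ.≤ g a b) →
                   disjointSum n f ℕ.≤ disjointSum n g
disjointSum-mono zero    f≤g = f≤g [] [] ≡.refl
disjointSum-mono (suc n) f≤g = ℕ.+-mono-≤ (ℕ.+-mono-≤
  (disjointSum-mono n λ a b → f≤g (false ∷ a) (false ∷ b))
  (disjointSum-mono n λ a b → f≤g (true ∷ a) (false ∷ b)))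
  (disjointSum-mono n λ a b → f≤g (false ∷ a) (true ∷ b))

disjointSum-+ : ∀ n f g → disjointSum n (λ a b → f a b ℕ.+ g a b) ≡ disjointSum n f ℕ.+ disjointSum n g
disjointSum-+ zero    f g = ≡.refl
disjointSum-+ (suc n) f g
  rewrite disjointSum-+ n (λ a b → f (false ∷ a) (false ∷ b)) (λ a b → g (false ∷ a) (false ∷ b))
        | disjointSum-+ n (λ a b → f (true ∷ a) (false ∷ b)) (λ a b → g (true ∷ a) (false ∷ b))
        | disjointSum-+ n (λ a b → f (false ∷ a) (true ∷ b)) (λ a b → g (false ∷ a) (true ∷ b))
        = interchange (disjointSum n (λ a b → f (false ∷ a) (false ∷ b))) (disjointSum n (λ a b → g (false ∷ a) (false ∷ b)))
                      (disjointSum n (λ a b → f (true ∷ a) (false ∷ b))) (disjointSum n (λ a b → g (true ∷ a) (false ∷ b)))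
                      (disjointSum n (λ a b → f (false ∷ a) (true ∷ b))) (disjointSum n (λ a b → g (false ∷ a) (true ∷ b)))
  where
  interchange : ∀ p q r s t u → p ℕ.+ q ℕ.+ (r ℕ.+ s) ℕ.+ (t ℕ.+ u) ≡ p ℕ.+ r ℕ.+ t ℕ.+ (q ℕ.+ s ℕ.+ u)
  interchange = solve-∀

disjointSum-0 : ∀ n → disjointSum n (λ _ _ → 0) ≡ 0
disjointSum-0 zero    = ≡.refl
disjointSum-0 (suc n) rewrite disjointSum-0 n = ≡.refl

disjointSum-1 : ∀ n → disjointSum n (λ _ _ → 1) ≡ 3 ℕ.^ n
disjointSum-1 zero    = ≡.refl
disjointSum-1 (suc n) rewrite disjointSum-1 n = triple (3 ℕ.^ n)
  where
  triple : ∀ t → t ℕ.+ t ℕ.+ t ≡ 3 ℕ.* t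
  triple = solve-∀

indicator : Bool → ℕ
indicator p = if p then 1 else 0

-- For p = [a ∈ A₀], q = [a ∈ A₁], r = [b ∈ B₀], s = [b ∈ B₁]: the right-hand side is the
-- indicator of (A₀ ∪ A₁) × B₀ plus that of A₀ × (B₀ ∪ B₁).
slices≤ : ∀ p q r s → q ∧ s ≡ false →
          indicator (p ∧ r) ℕ.+ indicator (q ∧ r) ℕ.+ indicator (p ∧ s)
          ℕ.≤ indicator ((p ∨ q) ∧ r) ℕ.+ indicator (p ∧ (r ∨ s))
slices≤ p     true  r     true  ()
slices≤ false false r     s     _ = ℕ.z≤n
slices≤ true  false false s     _ = ℕ.≤-refl
slices≤ true  false true  false _ = ℕ.s≤s ℕ.z≤n
slices≤ true  false true  true  _ = ℕ.≤-refl
slices≤ false true  false false _ = ℕ.≤-refl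
slices≤ false true  true  false _ = ℕ.≤-refl
slices≤ true  true  false false _ = ℕ.≤-refl
slices≤ true  true  true  false _ = ℕ.≤-refl

Family : ℕ → Set
Family n = Subset n → Bool

rectangle : ∀ {n} → Family n → Family n → Subset n → Subset n → ℕ
rectangle A B a b = indicator (A a ∧ B b)

Avoids1 : ∀ {n} → Family n → Family n → Set
Avoids1 A B = ∀ a b → T (A a) → T (B b) → inner a b ≢ 1

-- Induction on the ground set. The first element splits the disjoint pairs of the rectangle into
-- three slices, which `slices≤` bounds by two rectangles over the remaining elements. Both inherit
-- the avoidance property, so one more element at most doubles the count.
rectangle-bound : ∀ n (A B : Family n) → Avoids1 A B → disjointSum n (rectangle A B) ℕ.≤ 2 ℕ.^ n
rectangle-bound zero A B _ with A [] ∧ B []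
... | false = ℕ.z≤n
... | true  = ℕ.≤-refl
rectangle-bound (suc n) A B avoids = begin
  disjointSum n (rectangle A₀ B₀) ℕ.+ disjointSum n (rectangle A₁ B₀) ℕ.+ disjointSum n (rectangle A₀ B₁)
    ≡⟨ ≡.cong (ℕ._+ disjointSum n (rectangle A₀ B₁)) (disjointSum-+ n (rectangle A₀ B₀) (rectangle A₁ B₀)) ⟨
  disjointSum n (λ a b → rectangle A₀ B₀ a b ℕ.+ rectangle A₁ B₀ a b) ℕ.+ disjointSum n (rectangle A₀ B₁)
    ≡⟨ disjointSum-+ n (λ a b → rectangle A₀ B₀ a b ℕ.+ rectangle A₁ B₀ a b) (rectangle A₀ B₁) ⟨
  disjointSum n (λ a b → rectangle A₀ B₀ a b ℕ.+ rectangle A₁ B₀ a b ℕ.+ rectangle A₀ B₁ a b)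
    ≤⟨ disjointSum-mono n (λ a b a∩b≡∅ → slices≤ (A₀ a) (A₁ a) (B₀ b) (B₁ b) (excluded a b a∩b≡∅)) ⟩
  disjointSum n (λ a b → rectangle A₀₁ B₀ a b ℕ.+ rectangle A₀ B₀₁ a b)
    ≡⟨ disjointSum-+ n (rectangle A₀₁ B₀) (rectangle A₀ B₀₁) ⟩
  disjointSum n (rectangle A₀₁ B₀) ℕ.+ disjointSum n (rectangle A₀ B₀₁)
    ≤⟨ ℕ.+-mono-≤ (rectangle-bound n A₀₁ B₀ avoids-A₀₁B₀) (rectangle-bound n A₀ B₀₁ avoids-A₀B₀₁) ⟩
  2 ℕ.^ n ℕ.+ 2 ℕ.^ n
    ≡⟨ ≡.cong (2 ℕ.^ n ℕ.+_) (ℕ.+-identityʳ (2 ℕ.^ n)) ⟨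
  2 ℕ.^ suc n ∎
  where
  open ℕ.≤-Reasoning
  A₀ A₁ B₀ B₁ A₀₁ B₀₁ : Family n
  A₀ a = A (false ∷ a)
  A₁ a = A (true ∷ a)
  B₀ b = B (false ∷ b)
  B₁ b = B (true ∷ b)
  A₀₁ a = A₀ a ∨ A₁ a
  B₀₁ b = B₀ b ∨ B₁ b

  -- Adding a common element to disjoint sets would create an intersection of size exactly 1.
  excluded : ∀ a b → inner a b ≡ 0 → A₁ a ∧ B₁ b ≡ false
  excluded a b a∩b≡∅ with A₁ a | B₁ b | avoids (true ∷ a) (true ∷ b)
  ... | false | _     | _ = ≡.refl
  ... | true  | false | _ = ≡.refl
  ... | true  | true  | avoid = ⊥-elim (avoid _ _ (≡.cong suc a∩b≡∅))

  -- The first element is missing from the second set, so whichever way it is added to the first set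
  -- the intersection does not change.
  avoids-A₀₁B₀ : Avoids1 A₀₁ B₀
  avoids-A₀₁B₀ a b Aa with Equivalence.to (Bool.T-∨ {A₀ a}) Aa
  ... | inj₁ A₀a = avoids (false ∷ a) (false ∷ b) A₀a
  ... | inj₂ A₁a = avoids (true ∷ a) (false ∷ b) A₁a

  avoids-A₀B₀₁ : Avoids1 A₀ B₀₁
  avoids-A₀B₀₁ a b Aa Bb with Equivalence.to (Bool.T-∨ {B₀ b}) Bb
  ... | inj₁ B₀b = avoids (false ∷ a) (false ∷ b) Aa B₀b
  ... | inj₂ B₁b = avoids (false ∷ a) (true ∷ b) Aa B₁b

rectangles-bound : ∀ n {r} (A B : Fin r → Family n) → (∀ i → Avoids1 (A i) (B i)) →
                   disjointSum n (λ a b → sumℕ (λ i → rectangle (A i) (B i) a b)) ℕ.≤ r ℕ.* 2 ℕ.^ n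
rectangles-bound n {zero}  A B _ = ℕ.≤-reflexive (disjointSum-0 n)
rectangles-bound n {suc r} A B avoids = ℕ.≤-trans
  (ℕ.≤-reflexive (disjointSum-+ n (rectangle (A zero) (B zero)) (λ a b → sumℕ (λ i → rectangle (A (suc i)) (B (suc i)) a b))))
  (ℕ.+-mono-≤ (rectangle-bound n (A zero) (B zero) (avoids zero))
    (rectangles-bound n (A ∘ suc) (B ∘ suc) (avoids ∘ suc)))

1≤sum : ∀ {r} (f : Fin r → ℕ) i → 1 ℕ.≤ f i → 1 ℕ.≤ sumℕ f
1≤sum f zero    1≤fi = ℕ.≤-trans 1≤fi (ℕ.m≤m+n _ _)
1≤sum f (suc i) 1≤fi = ℕ.≤-trans (1≤sum (f ∘ suc) i 1≤fi) (ℕ.m≤n+m _ _)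

-- Count the 3ⁿ disjoint pairs: each lies in some rectangle, and each of the r rectangles holds at
-- most 2ⁿ of them.
rectangle-cover-bound : ∀ n {r} (A B : Fin r → Family n) → (∀ i → Avoids1 (A i) (B i)) →
                        (∀ a b → inner a b ≡ 0 → ∃[ i ] T (A i a) × T (B i b)) →
                        3 ℕ.^ n ℕ.≤ r ℕ.* 2 ℕ.^ n
rectangle-cover-bound n A B avoids covers = ℕ.≤-trans
  (ℕ.≤-trans (ℕ.≤-reflexive (≡.sym (disjointSum-1 n)))
    (disjointSum-mono n λ a b a∩b≡∅ → let (i , Aa , Bb) = covers a b a∩b≡∅ in
      1≤sum (λ i → rectangle (A i) (B i) a b) i (inside (A i a) (B i b) Aa Bb)))
  (rectangles-bound n A B avoids)
  where
  inside : ∀ p q → T p → T q → 1 ℕ.≤ indicator (p ∧ q)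
  inside true true _ _ = ℕ.≤-refl

^-distribʳ-* : ∀ n x y → (x ℕ.* y) ℕ.^ n ≡ x ℕ.^ n ℕ.* y ℕ.^ n
^-distribʳ-* zero    x y = ≡.refl
^-distribʳ-* (suc n) x y =
  ≡.trans (≡.cong (x ℕ.* y ℕ.*_) (^-distribʳ-* n x y)) (ℕ.[m*n]*[o*p]≡[m*o]*[n*p] x y _ _)

-- Squaring gives 9ⁿ ≤ r²4ⁿ, and 2ⁿ4ⁿ = 8ⁿ ≤ 9ⁿ. The square form avoids a square root of 2.
2^n≤r² : ∀ n r → 3 ℕ.^ n ℕ.≤ r ℕ.* 2 ℕ.^ n → 2 ℕ.^ n ℕ.≤ r ℕ.* r
2^n≤r² n r 3ⁿ≤r2ⁿ = ℕ.*-cancelʳ-≤ (2 ℕ.^ n) (r ℕ.* r) (t ℕ.* t) {{ℕ.m*n≢0 t t {{ℕ.m^n≢0 2 n}} {{ℕ.m^n≢0 2 n}}}} (begin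
  t ℕ.* (t ℕ.* t)           ≡⟨ ≡.cong (t ℕ.*_) (^-distribʳ-* n 2 2) ⟨
  t ℕ.* 4 ℕ.^ n             ≡⟨ ^-distribʳ-* n 2 4 ⟨
  8 ℕ.^ n                   ≤⟨ ℕ.^-monoˡ-≤ n {8} {9} (ℕ.n≤1+n 8) ⟩
  9 ℕ.^ n                   ≡⟨ ^-distribʳ-* n 3 3 ⟩
  3 ℕ.^ n ℕ.* 3 ℕ.^ n       ≤⟨ ℕ.*-mono-≤ 3ⁿ≤r2ⁿ 3ⁿ≤r2ⁿ ⟩
  r ℕ.* t ℕ.* (r ℕ.* t)     ≡⟨ ℕ.[m*n]*[o*p]≡[m*o]*[n*p] r t r t ⟩
  r ℕ.* r ℕ.* (t ℕ.* t)     ∎)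
  where
  open ℕ.≤-Reasoning
  t = 2 ℕ.^ n

-- Faces of a formulation and separation of points from them

module Separation (em : ExcludedMiddle 0ℓ) (R : RealNumbers) where
  open OrderedField R
  open LinearForms R
  open CutCorrelation R

  linear : ∀ {d} (f : Form d) α β x y →
           ⟦ f ⟧ (λ j → α * x j + β * y j) ≈ α * ⟦ f ⟧ x + β * ⟦ f ⟧ y
  -- A `sum` over two indices unfolds with a trailing `0#`, which is inserted before `combination`
  -- and removed after it.
  linear f α β x y = trans (Form.respects f (λ j → +-congˡ (sym (+-identityʳ (β * y j)))))
    (trans (Form.combination f {2} (λ { zero → α ; (suc _) → β }) (λ { zero → x ; (suc _) → y }))
      (+-congˡ (+-identityʳ (β * ⟦ f ⟧ y))))

  dot : ∀ {d} → Point d → Form d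
  dot c = form (λ x → sum λ j → c j * x j) c (λ x → refl)

  half-double : ∀ x → ½ * x + ½ * x ≈ x
  half-double x = trans (solve 2 (λ h x → h :* x :+ h :* x := con (ℤ.+ 2) :* h :* x) refl ½ x)
    (trans (*-congʳ 2*½≈1) (*-identityˡ x))

  0≤2 : 0# ≤ 1# + 1#
  0≤2 = +-nonNeg 0≤1 0≤1

  0≤½ : 0# ≤ ½
  0≤½ = inverse-nonNeg 0≤2 2*½≈1

  -- Since x + y = 2g and y ≤ g, the value x cannot lie below g.
  midpoint-extremal : ∀ {x y g} → x ≤ g → y ≤ g → ½ * x + ½ * y ≈ g → x ≈ g
  midpoint-extremal {x} {y} {g} x≤g y≤g mid≈g = antisym x≤g (begin
    g                                     ≈⟨ solve 1 (λ g → g := con (ℤ.+ 2) :* g :- g) refl g ⟩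
    (1# + 1#) * g - g                     ≈⟨ +-congʳ (*-congˡ mid≈g) ⟨
    (1# + 1#) * (½ * x + ½ * y) - g       ≈⟨ +-congʳ (solve 3 (λ h x y → con (ℤ.+ 2) :* (h :* x :+ h :* y) := con (ℤ.+ 2) :* h :* (x :+ y)) refl ½ x y) ⟩
    (1# + 1#) * ½ * (x + y) - g           ≈⟨ +-congʳ (trans (*-congʳ 2*½≈1) (*-identityˡ _)) ⟩
    x + y - g                             ≈⟨ +-comm _ _ ⟩
    - g + (x + y)                         ≤⟨ +-monoʳ-≤ (- g) (+-monoʳ-≤ x y≤g) ⟩
    - g + (x + g)                         ≈⟨ solve 2 (λ x g → :- g :+ (x :+ g) := x) refl x g ⟩
    x                                     ∎)
    where open ≤-Reasoning

  -- For t = 0 take ε = 1. Otherwise take ε = s/t, which is positive because s = 0 would force t =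
  -- 0.
  ratio : ∀ {s t} → 0# ≤ s → 0# ≤ t → (s ≈ 0# → t ≈ 0#) → ∃[ ε ] 0# < ε × ε * t ≤ s
  ratio {s} {t} 0≤s 0≤t s≈0⇒t≈0 with em {t ≈ 0#}
  ... | yes t≈0 = 1# , 0<1 , ≤-respˡ-≈ (trans (sym t≈0) (sym (*-identityˡ t))) 0≤s
  ... | no t≉0 with inverse t t≉0
  ...   | u , tu≈1 = s * u , (*-nonNeg 0≤s (inverse-nonNeg 0≤t tu≈1) , λ 0≈su → t≉0 (s≈0⇒t≈0
              (trans (sym sut≈s) (trans (*-congʳ (sym 0≈su)) (zeroˡ t)))))
          , ≤-reflexive sut≈s
    where
    sut≈s : s * u * t ≈ s
    sut≈s = trans (solve 3 (λ s u t → s :* u :* t := s :* (t :* u)) refl s u t)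
      (trans (*-congˡ tu≈1) (*-identityʳ s))

  -- As every t is nonnegative, the smaller of two admissible factors serves both; over finitely
  -- many indices the minimum stays positive.
  common-ratio : ∀ {r} {s t : Fin r → ℝ} → (∀ i → 0# ≤ s i) → (∀ i → 0# ≤ t i) →
                 (∀ i → s i ≈ 0# → t i ≈ 0#) → ∃[ ε ] 0# < ε × (∀ i → ε * t i ≤ s i)
  common-ratio {zero} _ _ _ = 1# , 0<1 , λ ()
  common-ratio {suc r} 0≤s 0≤t s⇒t
    with ratio (0≤s zero) (0≤t zero) (s⇒t zero) | common-ratio (0≤s ∘ suc) (0≤t ∘ suc) (s⇒t ∘ suc)
  ... | ε , 0<ε , εt≤s | η , 0<η , ηt≤s with total ε η
  ...   | inj₁ ε≤η = ε , 0<ε , λ { zero → εt≤s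
                                 ; (suc i) → ≤-trans (*-monoʳ-≤-nonNeg (0≤t (suc i)) ε≤η) (ηt≤s i) }
  ...   | inj₂ η≤ε = η , 0<η , λ { zero → ≤-trans (*-monoʳ-≤-nonNeg (0≤t zero) η≤ε) εt≤s
                                 ; (suc i) → ηt≤s i }

  -- A relative interior point, found by averaging: the midpoint lies on a face only if both ends do.
  generic-point : ∀ {X : Set} {r} (Tight : Fin r → X → Set) (mid : X → X → X) →
                  (∀ i z w → Tight i (mid z w) → Tight i z × Tight i w) →
                  X → ∃[ z ] (∀ i → Tight i z → ∀ w → Tight i w)
  generic-point {r = zero}  Tight mid extremal z = z , λ ()
  generic-point {X} {suc r} Tight mid extremal z₀
    with generic-point (Tight ∘ suc) mid (extremal ∘ suc) z₀ | em {∃[ w ] ¬ Tight zero w}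
  ... | z , generic | yes (w , ¬tight) = mid z w , λ
    { zero tight → ⊥-elim (¬tight (proj₂ (extremal zero z w tight)))
    ; (suc i) tight → generic i (proj₁ (extremal (suc i) z w tight)) }
  ... | z , generic | no all-tight = z , λ
    { zero _ w → decidable-stable em (λ ¬tight → all-tight (w , ¬tight))
    ; (suc i) → generic i }

  module Formulation {d k a r} {P : Pred (Point d) 0ℓ} (sys : LinearSystem d k a r) (ef : IsEF P sys) where
    open LinearSystem sys

    lhs : ∀ {m} → Matrix m d → Matrix m k → Fin m → Point d × Point k → ℝ
    lhs E F i (x , y) = ⟦ dot (E i) ⟧ x + ⟦ dot (F i) ⟧ y

    Feasible : Point d × Point k → Set
    Feasible (x , y) = Satisfies x y

    Tight : Fin r → Point d × Point k → Set
    Tight i z = lhs E≤ F≤ i z ≈ g≤ i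

    combo : ℝ → ℝ → Point d × Point k → Point d × Point k → Point d × Point k
    combo α β (x , y) (x′ , y′) = (λ j → α * x j + β * x′ j) , (λ j → α * y j + β * y′ j)

    lhs-combo : ∀ {m} (E : Matrix m d) (F : Matrix m k) i α β z w →
                lhs E F i (combo α β z w) ≈ α * lhs E F i z + β * lhs E F i w
    lhs-combo E F i α β (x , y) (x′ , y′) = trans
      (+-cong (linear (dot (E i)) α β x x′) (linear (dot (F i)) α β y y′))
      (solve 6 (λ α β p p′ q q′ → α :* p :+ β :* p′ :+ (α :* q :+ β :* q′) := α :* (p :+ q) :+ β :* (p′ :+ q′))
        refl α β _ _ _ _)

    -- A coefficient may be negative, as in a point beyond a segment. Equations survive any affine
    -- combination, but inequalities have to be supplied.
    combo-feasible : ∀ {α β z w} → α + β ≈ 1# → Feasible z → Feasible w →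
                     (∀ i → α * lhs E≤ F≤ i z + β * lhs E≤ F≤ i w ≤ g≤ i) → Feasible (combo α β z w)
    combo-feasible {α} {β} {z} {w} α+β≈1 (z⁼ , _) (w⁼ , _) ineq =
      (λ i → trans (lhs-combo E⁼ F⁼ i α β z w) (trans (+-cong (*-congˡ (z⁼ i)) (*-congˡ (w⁼ i)))
        (trans (sym (distribʳ (g⁼ i) α β)) (trans (*-congʳ α+β≈1) (*-identityˡ (g⁼ i))))))
      , λ i → ≤-respˡ-≈ (sym (lhs-combo E≤ F≤ i α β z w)) (ineq i)

    feasible⇒P : ∀ {z} → Feasible z → P (proj₁ z)
    feasible⇒P {x , y} s = Equivalence.from (ef x) (y , s)

    -- If every inequality tight at z were tight at p, the segment from p to z could be
    -- prolonged beyond z inside the polyhedron, which the maximality of f at z forbids.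
    separation : ∀ (f : Form d) {M} → (∀ x → P x → ⟦ f ⟧ x ≤ M) →
                 ∀ z p → Feasible z → Feasible p → ⟦ f ⟧ (proj₁ z) ≈ M → ¬ ⟦ f ⟧ (proj₁ p) ≈ M →
                 ∃[ i ] Tight i z × ¬ Tight i p
    separation f {M} valid z p Fz@(_ , z≤) Fp@(_ , p≤) fz≈M fp≉M
      with em {∃[ i ] Tight i z × ¬ Tight i p}
    ... | yes found = found
    ... | no none = ⊥-elim (fp≉M (antisym (valid _ (feasible⇒P Fp)) (*-cancelˡ-≤-pos (proj₁ (proj₂ scale)) εM≤εfp)))
      where
      slack : Point d × Point k → Fin r → ℝ
      slack w i = g≤ i - lhs E≤ F≤ i w

      slack≈0⇒tight : ∀ w i → slack w i ≈ 0# → Tight i w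
      slack≈0⇒tight w i s≈0 = trans (solve 2 (λ l g → l := g :- (g :- l)) refl _ (g≤ i))
        (trans (+-congˡ (trans (-‿cong s≈0) -0#≈0#)) (+-identityʳ (g≤ i)))

      tight⇒slack≈0 : ∀ w i → Tight i w → slack w i ≈ 0#
      tight⇒slack≈0 w i t = trans (+-congˡ (-‿cong t)) (-‿inverseʳ (g≤ i))

      scale : ∃[ ε ] 0# < ε × (∀ i → ε * slack p i ≤ slack z i)
      scale = common-ratio (λ i → x≤y⇒0≤y-x (z≤ i)) (λ i → x≤y⇒0≤y-x (p≤ i))
        -- A slack that vanishes at `z` but not at `p` would be the inequality that `none` rules
        -- out.
        λ i s≈0 → tight⇒slack≈0 p i (decidable-stable em λ ¬t → none (i , slack≈0⇒tight z i s≈0 , ¬t))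

      ε = proj₁ scale

      -- With slacks s at `z` and t at `p`, the slack here is (s - εt) + εs, a sum of nonnegative
      -- terms.
      beyond : Feasible (combo (1# + ε) (- ε) z p)
      beyond = combo-feasible {1# + ε} { - ε} {z} {p}
        (solve 1 (λ e → con (ℤ.+ 1) :+ e :+ :- e := con (ℤ.+ 1)) refl ε) Fz Fp
        λ i → 0≤y-x⇒x≤y (≤-respʳ-≈
          (solve 4 (λ e g l m → ((g :- l) :- e :* (g :- m)) :+ e :* (g :- l) := g :- ((con (ℤ.+ 1) :+ e) :* l :+ (:- e) :* m))
            refl ε (g≤ i) (lhs E≤ F≤ i z) (lhs E≤ F≤ i p))
          (+-nonNeg (x≤y⇒0≤y-x (proj₂ (proj₂ scale) i))
            (*-nonNeg (proj₁ (proj₁ (proj₂ scale))) (x≤y⇒0≤y-x (z≤ i)))))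

      -- The value of `f` at the prolonged point is (1 + ε)M - εf(p), and validity keeps it at most
      -- M. Cancelling ε gives M ≤ f(p), against the assumption on `p`.
      εM≤εfp : ε * M ≤ ε * ⟦ f ⟧ (proj₁ p)
      εM≤εfp = 0≤y-x⇒x≤y (≤-respʳ-≈
        (trans (+-congˡ (-‿cong (trans (linear f (1# + ε) (- ε) (proj₁ z) (proj₁ p)) (+-congʳ (*-congˡ fz≈M)))))
          (solve 3 (λ e m q → m :- ((con (ℤ.+ 1) :+ e) :* m :+ (:- e) :* q) := e :* q :- e :* m)
            refl ε M (⟦ f ⟧ (proj₁ p))))
        (x≤y⇒0≤y-x (valid _ (feasible⇒P beyond))))

    OnFace : Form d → ℝ → Set
    OnFace f M = Σ[ z ∈ Point d × Point k ] Feasible z × ⟦ f ⟧ (proj₁ z) ≈ M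

    face-midpoint : ∀ f M → OnFace f M → OnFace f M → OnFace f M
    face-midpoint f M (z , Fz , fz) (w , Fw , fw) = combo ½ ½ z w
      , combo-feasible {½} {½} {z} {w}
          (trans (+-cong (sym (*-identityʳ ½)) (sym (*-identityʳ ½))) (half-double 1#)) Fz Fw
          (λ i → ≤-respʳ-≈ (half-double (g≤ i)) (+-mono-≤
            (*-monoˡ-≤-nonNeg 0≤½ (proj₂ Fz i)) (*-monoˡ-≤-nonNeg 0≤½ (proj₂ Fw i))))
      , trans (linear f ½ ½ (proj₁ z) (proj₁ w)) (trans (+-cong (*-congˡ fz) (*-congˡ fw)) (half-double M))

    -- Neither endpoint exceeds the right-hand side, so an inequality tight at a midpoint is tight
    -- at both ends. This is what `generic-point` requires.
    relative-interior : ∀ f M → OnFace f M →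
      Σ[ z ∈ OnFace f M ] (∀ i → Tight i (proj₁ z) → ∀ (w : OnFace f M) → Tight i (proj₁ w))
    relative-interior f M = generic-point (λ i z → Tight i (proj₁ z)) (face-midpoint f M)
      λ i (z , Fz , _) (w , Fw , _) tight →
        let mid≈g = trans (sym (lhs-combo E≤ F≤ i ½ ½ z w)) tight in
        midpoint-extremal (proj₂ Fz i) (proj₂ Fw i) mid≈g
        , midpoint-extremal (proj₂ Fw i) (proj₂ Fz i) (trans (+-comm _ _) mid≈g)

  -- Valid inequalities and the size bound for the correlation polytope

  conv-vertex : ∀ {d} (S : Pred (Point d) 0ℓ) x → S x → conv S x
  conv-vertex S x Sx = 1 , (λ _ → x) , (λ _ → 1#) , (λ _ → Sx) , (λ _ → 0≤1) , +-identityʳ 1#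
    , λ j → sym (trans (+-identityʳ _) (*-identityˡ (x j)))

  conv-valid : ∀ {d} (S : Pred (Point d) 0ℓ) (f : Form d) {M} → (∀ x → S x → ⟦ f ⟧ x ≤ M) →
               ∀ x → conv S x → ⟦ f ⟧ x ≤ M
  conv-valid S f {M} valid x (k , p , w , Sp , 0≤w , ∑w , x≋) = begin
    ⟦ f ⟧ x                               ≈⟨ trans (Form.respects f x≋) (Form.combination f w p) ⟩
    sum (λ i → w i * ⟦ f ⟧ (p i))         ≤⟨ sum-mono-≤ (λ i → *-monoˡ-≤-nonNeg (0≤w i) (valid (p i) (Sp i))) ⟩
    sum (λ i → w i * M)                   ≈⟨ *-distribʳ-sum M w ⟨
    sum w * M                             ≈⟨ trans (*-congʳ ∑w) (*-identityˡ M) ⟩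
    M                                     ∎
    where open ≤-Reasoning

  correlation : ∀ {n} → Subset n → Point (n ℕ.* n)
  correlation {n} b p = let (i , j) = remQuot n p in bit (lookup b i) * bit (lookup b j)

  correlation-combine : ∀ {n} (b : Subset n) i j → correlation b (combine i j) ≈ bit (lookup b i) * bit (lookup b j)
  correlation-combine b i j = reflexive
    (≡.cong (λ (i , j) → bit (lookup b i) * bit (lookup b j)) (Fin.remQuot-combine i j))

  correlation-COR : ∀ {n} (b : Subset n) → CorrelationMatrix {n} (correlation b)
  correlation-COR b = (λ i → bit (lookup b i)) , (λ i → bit-01 (lookup b i)) , correlation-combine b

  -- ⟨2 diag(a) - aaᵀ, Y⟩, which is 1 - (1 - aᵀb)² at Y = bbᵀ.
  testForm : ∀ {n} → Subset n → Form (n ℕ.* n)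
  testForm a = (1# + 1#) ⊛ ⨁ (λ i → bit (lookup a i) ⊛ coord (combine i i))
    ⊕ - 1# ⊛ ⨁ (λ i → bit (lookup a i) ⊛ ⨁ (λ j → bit (lookup a j) ⊛ coord (combine i j)))

  -- Idempotence turns the diagonal sum into m = aᵀb, and on bbᵀ the double sum factors as m².
  testForm-correlation : ∀ {n} (a : Subset n) {x} (b : Point n) → (∀ i → b i * b i ≈ b i) →
    (∀ i j → x (combine i j) ≈ b i * b j) →
    let m = sum (λ i → bit (lookup a i) * b i) in ⟦ testForm a ⟧ x ≈ (1# + 1#) * m - m * m
  testForm-correlation {n} a {x} b b²≈b x≈ = trans
    (+-cong (*-congˡ (sum-cong-≋ {n} λ i → *-congˡ (trans (x≈ i i) (b²≈b i)))) (*-congˡ product))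
    (solve 1 (λ m → con (ℤ.+ 2) :* m :+ (:- con (ℤ.+ 1)) :* (m :* m) := con (ℤ.+ 2) :* m :- m :* m) refl m)
    where
    open import Relation.Binary.Reasoning.Setoid setoid
    c : Fin n → ℝ
    c i = bit (lookup a i)
    m = sum (λ i → c i * b i)
    product : sum (λ i → c i * sum (λ j → c j * x (combine i j))) ≈ m * m
    product = begin
      sum (λ i → c i * sum (λ j → c j * x (combine i j)))
        ≈⟨ sum-cong-≋ {n} (λ i → *-congˡ (sum-cong-≋ {n} λ j → trans (*-congˡ (x≈ i j))
             (solve 3 (λ c b b′ → c :* (b :* b′) := b :* (c :* b′)) refl (c j) (b i) (b j)))) ⟩
      sum (λ i → c i * sum (λ j → b i * (c j * b j)))
        ≈⟨ sum-cong-≋ {n} (λ i → trans (*-congˡ (sym (*-distribˡ-sum (b i) (λ j → c j * b j)))) (sym (*-assoc (c i) (b i) m))) ⟩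
      sum (λ i → c i * b i * m)
        ≈⟨ *-distribʳ-sum m (λ i → c i * b i) ⟨
      m * m ∎

  01-idempotent : ∀ {x} → x ≈ 0# ⊎ x ≈ 1# → x * x ≈ x
  01-idempotent (inj₁ x≈0) = trans (*-congʳ x≈0) (trans (zeroˡ _) (sym x≈0))
  01-idempotent (inj₂ x≈1) = trans (*-congʳ x≈1) (*-identityˡ _)

  -- At a generator the slack 1 - (2m - m²) is the square (1 - m)², and validity passes to the hull.
  testForm-valid : ∀ {n} (a : Subset n) x → COR n x → ⟦ testForm a ⟧ x ≤ 1#
  testForm-valid {n} a = conv-valid CorrelationMatrix (testForm a) λ x (b , b01 , x≈) →
    let m = sum (λ i → bit (lookup a i) * b i) in
    ≤-respˡ-≈ (sym (testForm-correlation a {x} b (λ i → 01-idempotent (b01 i)) x≈))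
      (0≤y-x⇒x≤y (≤-respʳ-≈
        (solve 1 (λ m → (con (ℤ.+ 1) :- m) :* (con (ℤ.+ 1) :- m) := con (ℤ.+ 1) :- (con (ℤ.+ 2) :* m :- m :* m)) refl m)
        (square-nonNeg (1# - m))))

  inner-sum : ∀ {n} (a b : Subset n) → sum (λ i → bit (lookup a i) * bit (lookup b i)) ≈ fromℕ (inner a b)
  inner-sum []          []          = refl
  inner-sum (false ∷ a) (q ∷ b)     = trans (+-cong (zeroˡ _) (inner-sum a b)) (+-identityˡ _)
  inner-sum (true ∷ a)  (false ∷ b) = trans (+-cong (zeroʳ _) (inner-sum a b)) (+-identityˡ _)
  inner-sum (true ∷ a)  (true ∷ b)  = +-cong (*-identityˡ _) (inner-sum a b)

  testForm-inner : ∀ {n} (a b : Subset n) → let m = fromℕ (inner a b) in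
                ⟦ testForm a ⟧ (correlation b) ≈ (1# + 1#) * m - m * m
  testForm-inner a b = trans
    (testForm-correlation a {correlation b} (λ i → bit (lookup b i)) (λ i → 01-idempotent (bit-01 (lookup b i))) (correlation-combine b))
    (+-cong (*-congˡ (inner-sum a b)) (-‿cong (*-cong (inner-sum a b) (inner-sum a b))))

  testForm-tight : ∀ {n} (a b : Subset n) → inner a b ≡ 1 → ⟦ testForm a ⟧ (correlation b) ≈ 1#
  testForm-tight a b a∩b≡1 = trans (testForm-inner a b)
    (trans (reflexive (≡.cong (λ m → (1# + 1#) * fromℕ m - fromℕ m * fromℕ m) a∩b≡1))
      (solve 0 (con (ℤ.+ 2) :* (con (ℤ.+ 1) :+ con (ℤ.+ 0)) :- (con (ℤ.+ 1) :+ con (ℤ.+ 0)) :* (con (ℤ.+ 1) :+ con (ℤ.+ 0)) := con (ℤ.+ 1)) refl))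

  testForm-slack : ∀ {n} (a b : Subset n) → inner a b ≡ 0 → ¬ ⟦ testForm a ⟧ (correlation b) ≈ 1#
  testForm-slack a b a∩b≡0 f≈1 = 0≉1 (trans (sym (trans (testForm-inner a b)
    (trans (reflexive (≡.cong (λ m → (1# + 1#) * fromℕ m - fromℕ m * fromℕ m) a∩b≡0))
      (solve 0 (con (ℤ.+ 2) :* con (ℤ.+ 0) :- con (ℤ.+ 0) :* con (ℤ.+ 0) := con (ℤ.+ 0)) refl)))) f≈1)

  -- The order is positive so that `strict-somewhere` has a first coordinate to change. COR(0) is a
  -- single point with a formulation of size 0, and the bound fails for it.
  COR-size-bound : ∀ n r → HasEFOfSize (COR (suc n)) r → 3 ℕ.^ suc n ℕ.≤ r ℕ.* 2 ℕ.^ suc n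
  COR-size-bound n r (k , _ , sys , ef) = rectangle-cover-bound (suc n) A B avoids covers
    where
    open Formulation sys ef

    lift : Subset (suc n) → Point k
    lift b = proj₁ (Equivalence.to (ef (correlation b)) (conv-vertex CorrelationMatrix _ (correlation-COR b)))

    vertex : Subset (suc n) → Point (suc n ℕ.* suc n) × Point k
    vertex b = correlation b , lift b

    vertex-feasible : ∀ b → Feasible (vertex b)
    vertex-feasible b = proj₂ (Equivalence.to (ef (correlation b)) (conv-vertex CorrelationMatrix _ (correlation-COR b)))

    TightOnFace : Fin r → Subset (suc n) → Set
    TightOnFace i a = ∀ (w : OnFace (testForm a) 1#) → Tight i (proj₁ w)

    -- Excluded middle turns the two geometric conditions into Boolean families, which can be
    -- counted.
    A B : Fin r → Family (suc n)
    A i a = isYes (em {TightOnFace i a})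
    B i b = isYes (em {¬ Tight i (vertex b)})

    avoids : ∀ i → Avoids1 (A i) (B i)
    avoids i a b Aa Bb a∩b≡1 =
      toWitness {a? = em} Bb (toWitness {a? = em} Aa (vertex b , vertex-feasible b , testForm-tight a b a∩b≡1))

    -- For a = ∅ the face is empty.  Instead prolong the segment from the lift of b to the lift of b
    -- with one element changed, which leaves 0 ≤ Y₀₀ ≤ 1.
    strict-somewhere : ∀ b → ∃[ i ] ¬ Tight i (vertex b)
    strict-somewhere (false ∷ b) = let (i , _ , strict) = separation (coord zero) valid
                                         (vertex (true ∷ b)) (vertex (false ∷ b)) (vertex-feasible (true ∷ b)) (vertex-feasible (false ∷ b))
                                         (*-identityˡ 1#) (λ eq → 0≉1 (trans (sym (zeroˡ 0#)) eq))
                                   in i , strict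
      where
      valid : ∀ x → COR (suc n) x → x zero ≤ 1#
      valid = conv-valid CorrelationMatrix (coord zero) λ x (b , b01 , x≈) → ≤-respˡ-≈ (sym (x≈ zero zero)) (01≤1 (b01 zero))
        where
        01≤1 : ∀ {t} → t ≈ 0# ⊎ t ≈ 1# → t * t ≤ 1#
        01≤1 t01@(inj₁ t≈0) = ≤-respˡ-≈ (sym (trans (01-idempotent t01) t≈0)) 0≤1
        01≤1 t01@(inj₂ t≈1) = ≤-reflexive (trans (01-idempotent t01) t≈1)
    strict-somewhere (true ∷ b) = let (i , _ , strict) = separation (- 1# ⊛ coord zero) valid
                                         (vertex (false ∷ b)) (vertex (true ∷ b)) (vertex-feasible (false ∷ b)) (vertex-feasible (true ∷ b))
                                         (trans (*-congˡ (zeroˡ 0#)) (zeroʳ _))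
                                         (λ eq → 0≉1 (trans
                                           (solve 0 (con (ℤ.+ 0) := con (ℤ.+ 1) :+ (:- con (ℤ.+ 1)) :* (con (ℤ.+ 1) :* con (ℤ.+ 1))) refl)
                                           (trans (+-congˡ eq) (+-identityʳ 1#))))
                                   in i , strict
      where
      valid : ∀ x → COR (suc n) x → - 1# * x zero ≤ 0#
      valid = conv-valid CorrelationMatrix (- 1# ⊛ coord zero) λ x (b , b01 , x≈) →
        0≤y-x⇒x≤y (≤-respʳ-≈ (trans (sym (x≈ zero zero)) (solve 1 (λ t → t := con (ℤ.+ 0) :- (:- con (ℤ.+ 1)) :* t) refl (x zero)))
          (square-nonNeg (b zero)))

    covers : ∀ a b → inner a b ≡ 0 → ∃[ i ] T (A i a) × T (B i b)
    covers a b a∩b≡0 with em {OnFace (testForm a) 1#}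
    ... | yes w =
      -- The separating inequality is tight at a relative interior point, hence on the whole face,
      -- which puts `a` into `A i`.
      let (z , Fz , fz) , interior = relative-interior (testForm a) 1# w
          i , tight , strict = separation (testForm a) (testForm-valid a) z (vertex b) Fz (vertex-feasible b) fz (testForm-slack a b a∩b≡0)
      in i , fromWitness {a? = em} (interior i tight) , fromWitness {a? = em} strict
    ... | no empty =
      -- Every inequality is vacuously tight on an empty face, so any inequality strict at
      -- `vertex b` gives a covering rectangle.
      let i , strict = strict-somewhere b
      in i , fromWitness {a? = em} (λ w → ⊥-elim (empty w)) , fromWitness {a? = em} strict

-- Existence of the minimum size, and real powers of two

least : ExcludedMiddle 0ℓ → (P : ℕ → Set) → ∃ P → ∃[ r ] P r × (∀ s → P s → r ℕ.≤ s)
least em P (n , Pn) = search n 0 (λ s _ → ℕ.z≤n) (≡.subst P (≡.sym (ℕ.+-identityʳ n)) Pn)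
  where
  -- Upward search: `r` stays a lower bound for all solutions, and the known solution `k + r` bounds
  -- the number of remaining steps.
  search : ∀ k r → (∀ s → P s → r ℕ.≤ s) → P (k ℕ.+ r) → ∃[ r ] P r × (∀ s → P s → r ℕ.≤ s)
  search zero    r r≤ Pr = r , Pr , r≤
  search (suc k) r r≤ Pkr with em {P r}
  ... | yes Pr = r , Pr , r≤
  ... | no ¬Pr = search k (suc r)
    (λ s Ps → ℕ.≤∧≢⇒< (r≤ s Ps) λ r≡s → ¬Pr (≡.subst P (≡.sym r≡s) Ps))
    (≡.subst P (≡.sym (ℕ.+-suc k r)) Pkr)

module Powers (em : ExcludedMiddle 0ℓ) (R : RealNumbers) where
  open OrderedField R
  open CutCorrelation R using (½; 2*½≈1)
  open Separation em R using (half-double; 0≤½)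

  *-pos : ∀ {x y} → 0# < x → 0# < y → 0# < x * y
  *-pos {x} {y} 0<x@(0≤x , _) 0<y@(0≤y , _) = *-nonNeg 0≤x 0≤y ,
    λ 0≈xy → <⇒≱ 0<y (*-cancelˡ-≤-pos 0<x (≤-reflexive (trans (sym 0≈xy) (sym (zeroʳ x)))))

  ^-pos : ∀ {x} n → 0# < x → 0# < x ^ n
  ^-pos zero    0<x = 0<1
  ^-pos (suc n) 0<x = *-pos 0<x (^-pos n 0<x)

  -- If y < x, then x is positive and yⁿ ≤ xⁿ, so xⁿx ≤ yⁿy ≤ xⁿy; cancelling xⁿ gives x ≤ y.
  ^-cancel-≤ : ∀ n {x y} → 0# ≤ x → 0# ≤ y → x ^ suc n ≤ y ^ suc n → x ≤ y
  ^-cancel-≤ n {x} {y} 0≤x 0≤y xⁿ≤yⁿ = decidable-stable em λ x≰y →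
    let y≤x = ≰⇒≥ x≰y
        0<x = 0≤x , λ 0≈x → x≰y (≤-respˡ-≈ 0≈x 0≤y)
    in x≰y (*-cancelˡ-≤-pos (^-pos n 0<x) (begin
      x ^ n * x   ≈⟨ *-comm _ _ ⟩
      x ^ suc n   ≤⟨ xⁿ≤yⁿ ⟩
      y * y ^ n   ≤⟨ *-monoˡ-≤-nonNeg 0≤y (^-mono-≤ n 0≤y y≤x) ⟩
      y * x ^ n   ≈⟨ *-comm _ _ ⟩
      x ^ n * y   ∎))
    where open ≤-Reasoning

  0<fromℕ : ∀ n → .{{ℕ.NonZero n}} → 0# < fromℕ n
  0<fromℕ (suc n) = 0≤fromℕ (suc n) , λ 0≈n → <⇒≱ 0<1
    (≤-respˡ-≈ (+-identityʳ 1#) (≤-respʳ-≈ (sym 0≈n) (+-monoʳ-≤ 1# (0≤fromℕ n))))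

  fromℕ2≈2 : fromℕ 2 ≈ 1# + 1#
  fromℕ2≈2 = +-congˡ (+-identityʳ 1#)

  0<2^ : ∀ m → 0# < fromℕ 2 ^ m
  0<2^ m = ^-pos m (0<fromℕ 2)

  fromℕ-2^ : ∀ m → fromℕ 2 ^ m ≈ fromℕ (2 ℕ.^ m)
  fromℕ-2^ m = sym (fromℕ-^ 2 m)

  -- In exponents, t is 2 to the power (k - m)/Q with (k - m)/Q ≤ y ≤ n/2, so t² ≤ 2ⁿ ≤ r². Without
  -- division this is the comparison of M²(t²)^Q with M²(r²)^Q, from which M², the Q-th power and
  -- the square are cancelled in turn.
  power-bound : ∀ {n r} {y} → fromℕ 2 * y ≤ fromℕ n → 2 ℕ.^ n ℕ.≤ r ℕ.* r →
                ∀ k m q t → fromℕ k ≤ fromℕ m + fromℕ (suc q) * y → IsRational2^ k m (suc q) t → t ≤ fromℕ r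
  power-bound {n} {r} {y} 2y≤n 2ⁿ≤r² k m q t k≤ (0≤t , 2ᵐt^q≈2ᵏ) =
    ^-cancel-≤ 1 0≤t (0≤fromℕ r) (≤-respˡ-≈ (square t) (≤-respʳ-≈ (square (fromℕ r))
      (^-cancel-≤ q (*-nonNeg 0≤t 0≤t) (*-nonNeg (0≤fromℕ r) (0≤fromℕ r))
        (*-cancelˡ-≤-pos (*-pos (0<2^ m) (0<2^ m)) (begin
          M * M * (t * t) ^ Q              ≈⟨ *-congˡ (^-distrib-* t t Q) ⟩
          M * M * (t ^ Q * t ^ Q)          ≈⟨ solve 2 (λ a b → a :* a :* (b :* b) := a :* b :* (a :* b)) refl M (t ^ Q) ⟩
          M * t ^ Q * (M * t ^ Q)          ≈⟨ *-cong 2ᵐt^q≈2ᵏ 2ᵐt^q≈2ᵏ ⟩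
          fromℕ 2 ^ k * fromℕ 2 ^ k        ≈⟨ ^-homo-* (fromℕ 2) k k ⟨
          fromℕ 2 ^ (k ℕ.+ k)              ≈⟨ fromℕ-2^ (k ℕ.+ k) ⟩
          fromℕ (2 ℕ.^ (k ℕ.+ k))          ≤⟨ fromℕ-mono-≤ exponents ⟩
          fromℕ (2 ℕ.^ m ℕ.* 2 ℕ.^ m ℕ.* (r ℕ.* r) ℕ.^ Q)
            ≈⟨ fromℕ-* (2 ℕ.^ m ℕ.* 2 ℕ.^ m) ((r ℕ.* r) ℕ.^ Q) ⟩
          fromℕ (2 ℕ.^ m ℕ.* 2 ℕ.^ m) * fromℕ ((r ℕ.* r) ℕ.^ Q)
            ≈⟨ *-cong (fromℕ-* (2 ℕ.^ m) (2 ℕ.^ m)) (fromℕ-^ (r ℕ.* r) Q) ⟩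
          fromℕ (2 ℕ.^ m) * fromℕ (2 ℕ.^ m) * fromℕ (r ℕ.* r) ^ Q
            ≈⟨ *-cong (*-cong (sym (fromℕ-2^ m)) (sym (fromℕ-2^ m))) (^-congˡ Q (fromℕ-* r r)) ⟩
          M * M * (fromℕ r * fromℕ r) ^ Q  ∎)))))
    where
    open ≤-Reasoning
    Q = suc q
    M = fromℕ 2 ^ m

    square : ∀ x → x * x ≈ x ^ 2
    square x = *-congˡ (sym (*-identityʳ x))

    2k≤2m+qn : k ℕ.+ k ℕ.≤ m ℕ.+ m ℕ.+ n ℕ.* Q
    2k≤2m+qn = fromℕ-cancel-≤ (begin
      fromℕ (k ℕ.+ k)                                         ≈⟨ fromℕ-+ k k ⟩
      fromℕ k + fromℕ k                                       ≤⟨ +-mono-≤ k≤ k≤ ⟩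
      (fromℕ m + fromℕ Q * y) + (fromℕ m + fromℕ Q * y)
        ≈⟨ solve 3 (λ m q y → (m :+ q :* y) :+ (m :+ q :* y) := (m :+ m) :+ q :* (con (ℤ.+ 2) :* y)) refl (fromℕ m) (fromℕ Q) y ⟩
      (fromℕ m + fromℕ m) + fromℕ Q * ((1# + 1#) * y)
        ≤⟨ +-monoʳ-≤ _ (*-monoˡ-≤-nonNeg (0≤fromℕ Q) (≤-respˡ-≈ (*-congʳ fromℕ2≈2) 2y≤n)) ⟩
      (fromℕ m + fromℕ m) + fromℕ Q * fromℕ n                 ≈⟨ +-cong (sym (fromℕ-+ m m)) (trans (*-comm _ _) (sym (fromℕ-* n Q))) ⟩
      fromℕ (m ℕ.+ m) + fromℕ (n ℕ.* Q)                       ≈⟨ fromℕ-+ (m ℕ.+ m) (n ℕ.* Q) ⟨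
      fromℕ (m ℕ.+ m ℕ.+ n ℕ.* Q)                             ∎)

    exponents : 2 ℕ.^ (k ℕ.+ k) ℕ.≤ 2 ℕ.^ m ℕ.* 2 ℕ.^ m ℕ.* (r ℕ.* r) ℕ.^ Q
    exponents = ℕ.≤-trans (ℕ.^-monoʳ-≤ 2 2k≤2m+qn) (ℕ.≤-trans
      (ℕ.≤-reflexive (≡.trans (ℕ.^-distribˡ-+-* 2 (m ℕ.+ m) (n ℕ.* Q))
        (≡.cong₂ ℕ._*_ (ℕ.^-distribˡ-+-* 2 m m) (≡.sym (ℕ.^-*-assoc 2 n Q)))))
      (ℕ.*-monoʳ-≤ (2 ℕ.^ m ℕ.* 2 ℕ.^ m) (ℕ.^-monoˡ-≤ Q 2ⁿ≤r²)))

  -- Completeness yields the supremum: the set of rational powers contains 1 = 2⁰ because y ≥ 0, and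
  -- r bounds it by `power-bound`. As the least upper bound, the supremum is at most r.
  2^≤ℕ : ∀ {n r y} → 0# ≤ y → fromℕ 2 * y ≤ fromℕ n → 2 ℕ.^ n ℕ.≤ r ℕ.* r → 2^ y ≤ℕ r
  2^≤ℕ {n} {r} {y} 0≤y 2y≤n 2ⁿ≤r² =
    let (z , sup) = complete _ (1# , 0 , 0 , 1 , ℕ.≤-refl , 0≤exponent , 0≤1 , 1≈1) (fromℕ r , bound)
    in z , sup , proj₂ sup (fromℕ r) bound
    where
    bound : IsUpperBound (λ t → ∃[ k ] ∃[ m ] ∃[ q ] 1 ℕ.≤ q
      × fromℕ k ≤ fromℕ m + fromℕ q * y × IsRational2^ k m q t) (fromℕ r)
    bound t (k , m , suc q , _ , k≤ , rational) = power-bound {n} {r} 2y≤n 2ⁿ≤r² k m q t k≤ rational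

    0≤exponent : fromℕ 0 ≤ fromℕ 0 + fromℕ 1 * y
    0≤exponent = +-nonNeg ≤-refl (*-nonNeg (0≤fromℕ 1) 0≤y)

    1≈1 : fromℕ 2 ^ 0 * 1# ^ 1 ≈ fromℕ 2 ^ 0
    1≈1 = trans (*-identityˡ _) (*-identityʳ 1#)

  0<½ : 0# < ½
  0<½ = 0≤½ , λ 0≈½ → 0≉1 (trans (sym (zeroʳ _)) (trans (*-congˡ 0≈½) 2*½≈1))

  2[½x]≈x : ∀ x → fromℕ 2 * (½ * x) ≈ x
  2[½x]≈x x = trans (*-congʳ fromℕ2≈2) (trans (sym (*-assoc _ _ _)) (trans (*-congʳ 2*½≈1) (*-identityˡ x)))

  ½[suc]≤ : ∀ m → 1 ℕ.≤ m → ½ * fromℕ (suc m) ≤ fromℕ m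
  ½[suc]≤ m 1≤m = begin
    ½ * fromℕ (suc m)           ≤⟨ *-monoˡ-≤-nonNeg 0≤½ (fromℕ-mono-≤ (ℕ.+-monoˡ-≤ m 1≤m)) ⟩
    ½ * fromℕ (m ℕ.+ m)         ≈⟨ *-congˡ (fromℕ-+ m m) ⟩
    ½ * (fromℕ m + fromℕ m)     ≈⟨ distribˡ ½ _ _ ⟩
    ½ * fromℕ m + ½ * fromℕ m   ≈⟨ half-double _ ⟩
    fromℕ m                     ∎
    where open ≤-Reasoning

theorem7 : ExcludedMiddle 0ℓ → (R : RealNumbers) → let open Polytopes R in
    (∃[ C ] 0# < C × (∀ n → 1 ℕ.≤ n →
    ∃[ r ] ∃[ s ] xc[ CUT (suc n) ]≡ r × xc[ COR n ]≡ s
    × r ≡ s × 2^ (C * fromℕ n) ≤ℕ s))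
    × (∃[ c ] 0# < c × (∃[ N ] (∀ n → N ℕ.≤ n →
    ∃[ r ] xc[ CUT n ]≡ r × 2^ (c * fromℕ n) ≤ℕ r)))
-- From 2ⁿ ≤ r² comes the exponent n/2, hence C = ½. For CUT(n) the correlation polytope has order n
-- - 1, and (n - 1)/2 ≥ n/4 once n ≥ 2, hence c = ¼ and N = 2.
theorem7 em R = (½ , 0<½ , first) , (½ * ½ , *-pos 0<½ 0<½ , 2 , second)
  where
  open OrderedField R
  open CutCorrelation R
  open Separation em R
  open Powers em R

  -- The two polytopes have formulations of the same sizes, so a least size for one is least for the
  -- other. The search starts from the formulation by all cut vectors.
  minimum : ∀ n → ∃[ r ] xc[ CUT (suc n) ]≡ r × xc[ COR n ]≡ r
  minimum n =
    let (r , cut-r , r≤) = least em (HasEFOfSize (CUT (suc n))) (_ , cut-hasEF (suc n))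
    in r , (cut-r , r≤) , Equivalence.to (CUT⇔COR n r) cut-r
         , λ s cor-s → r≤ s (Equivalence.from (CUT⇔COR n s) cor-s)

  xc-bound : ∀ n {r} → 1 ℕ.≤ n → xc[ COR n ]≡ r → 2 ℕ.^ n ℕ.≤ r ℕ.* r
  xc-bound (suc n) {r} _ (ef , _) = 2^n≤r² (suc n) r (COR-size-bound n r ef)

  first : ∀ n → 1 ℕ.≤ n → ∃[ r ] ∃[ s ] xc[ CUT (suc n) ]≡ r × xc[ COR n ]≡ s
    × r ≡ s × 2^ (½ * fromℕ n) ≤ℕ s
  first n 1≤n =
    let (r , xc-CUT , xc-COR) = minimum n
    in r , r , xc-CUT , xc-COR , ≡.refl
      , 2^≤ℕ {n} {r} (*-nonNeg 0≤½ (0≤fromℕ n)) (≤-reflexive (2[½x]≈x _)) (xc-bound n 1≤n xc-COR)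

  second : ∀ n → 2 ℕ.≤ n → ∃[ r ] xc[ CUT n ]≡ r × 2^ (½ * ½ * fromℕ n) ≤ℕ r
  second (suc n) (ℕ.s≤s 1≤n) =
    let (r , xc-CUT , xc-COR) = minimum n
    in r , xc-CUT
      , 2^≤ℕ {n} {r} (*-nonNeg (*-nonNeg 0≤½ 0≤½) (0≤fromℕ (suc n)))
          -- Twice the exponent (n + 1)/4 is (n + 1)/2, which is at most n as n ≥ 1.
          (≤-respˡ-≈ (sym (trans (*-congˡ (*-assoc ½ ½ _)) (2[½x]≈x _))) (½[suc]≤ n 1≤n))
          (xc-bound n 1≤n xc-COR)
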